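{- Let $d > 2$ be an integer. There exists a constant $C > 0$, depending at most on $d$ (in particular independent of $p$, $\ell$, $q$ and $E$), such that the following holds. Let $q = p^{\ell}$ be odd, where $p$ is a prime and $\ell \geq 1$ is an integer. If $E \subset \mathbb{Z}_q^d$ satisfies $$|E| \geq C (\ell + 1)\, q^{\frac{(2\ell - 1)d + 2}{2\ell}},$$ then $\Delta(E) = \mathbb{Z}_q$.
   Context: $\mathbb{Z}_q$ denotes the ring of integers modulo $q$, and $\mathbb{Z}_q^d = \mathbb{Z}_q \times \dots \times \mathbb{Z}_q$ is the free module of rank $d$ over $\mathbb{Z}_q$. For $x = (x_1,\dots,x_d) \in \mathbb{Z}_q^d$ put $\|x\| = x_1^2 + \dots + x_d^2 \in \mathbb{Z}_q$. For $E \subset \mathbb{Z}_q^d$, the distance set is $\Delta(E) = \{\|x-y\| : x, y \in E\} = \{(x_1-y_1)^2 + \dots + (x_d-y_d)^2 : x,y \in E\} \subset \mathbb{Z}_q$. -}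

module Defs where

open import Data.Fin using (Fin; toℕ; fromℕ<)
open import Data.Integer as ℤ using (ℤ; +_)
open import Data.Integer.DivMod using (n%ℕd<d)
open import Data.List using (List)
open import Data.List.Membership.Propositional using (_∈_)
open import Data.Nat as ℕ using (ℕ; NonZero; _^_)
open import Data.Product using (∃₂; _×_)
open import Data.Vec using (Vec; zipWith; map; foldr′)
open import Level using (0ℓ)
open import Relation.Binary.PropositionalEquality using (_≡_)
open import Relation.Unary using (Pred)

-- ℤ/qℤ on the least non-negative residues; its operations are those of ℤ
-- followed by reduction modulo q.
Zmod : ℕ → Set
Zmod q = Fin q

Zmod^ : ℕ → ℕ → Set
Zmod^ q d = Vec (Zmod q) d

module _ {q : ℕ} .{{_ : NonZero q}} where

  residue : ℤ → Zmod q
  residue i = fromℕ< (n%ℕd<d i q)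

  lift : Zmod q → ℤ
  lift a = + toℕ a

  0# : Zmod q
  0# = residue (+ 0)

  _⊕_ _⊖_ _⊗_ : Zmod q → Zmod q → Zmod q
  a ⊕ b = residue (lift a ℤ.+ lift b)
  a ⊖ b = residue (lift a ℤ.- lift b)
  a ⊗ b = residue (lift a ℤ.* lift b)

  _-ᵥ_ : ∀ {d} → Zmod^ q d → Zmod^ q d → Zmod^ q d
  _-ᵥ_ = zipWith _⊖_

  -- The sum of squares, as an element of ℤ/qℤ (no square root is taken).
  ‖_‖ : ∀ {d} → Zmod^ q d → Zmod q
  ‖ x ‖ = foldr′ _⊕_ 0# (map (λ a → a ⊗ a) x)

  -- A finite set E is given by a list of its elements; repetitions are
  -- immaterial here, but |E| = length E needs the list to be Unique.
  Δ : ∀ {d} → List (Zmod^ q d) → Pred (Zmod q) 0ℓ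
  Δ E t = ∃₂ λ x y → x ∈ E × y ∈ E × t ≡ ‖ x -ᵥ y ‖

-- For k ≥ 1, the real inequality  n ≥ c · b^(a/k)  with both (non-negative)
-- sides raised to the k-th power.
infix 4 _≥_·_^[_/_]
_≥_·_^[_/_] : (n c b a k : ℕ) → Set
n ≥ c · b ^[ a / k ] = n ^ k ℕ.≥ c ^ k ℕ.* b ^ a

{-# OPTIONS --safe #-}

-- A second-moment argument without characters; C = 1 works.  Put
-- aₖ(y) = pᵏ · #{x ∈ E : pᵏ ∣ ‖x − y‖ − t}.  Then a₀ = |E|, and a_ℓ = 0 on E if the
-- distance t is missing.  With m = pᵏ, the increment aₖ₊₁(y) − aₖ(y) is m · Σ_{x ∈ E} γ,
-- where γ(u) = p·[pm ∣ u] − [m ∣ u] is evaluated at u = −2 x·y + ‖x‖ + s, s = ‖y‖ − t.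
-- Let s range freely modulo n = pm and y over the whole of ℤ_q^d, and expand the
-- square of Σ_x γ: since γ has mean zero on every coset of m modulo n, the
-- cross term of x and x′ vanishes unless x ≡ x′ (mod n).  Hence
-- Σ_{y ∈ E} (aₖ₊₁ − aₖ)² ≤ |E| q^{2d} p^{2−d} for every k < ℓ, and Cauchy–Schwarz over k gives
-- |E|² p^{d−2} ≤ ℓ² q^{2d}, whereas density says |E|² p^{d−2} ≥ (ℓ+1)² q^{2d}.
module Submission where

open import Data.Empty using (⊥; ⊥-elim)
open import Data.Fin as Fin using (Fin; toℕ; _≟_)
open import Data.List using (List; []; _∷_; length)
open import Data.List.Membership.Propositional using (_∈_; find; lose)
open import Data.List.Relation.Unary.Any using (here; there; any?)
open import Data.List.Relation.Unary.Unique.Propositional using (Unique)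
open import Data.Nat as ℕ using (ℕ; zero; suc)
open import Data.Nat.Primality using (Prime; prime⇒nonZero; prime⇒irreducible)
open import Data.Product using (∃; _×_; _,_)
open import Data.Unit using (tt)
open import Defs
open import Function using (_∘_)
open import Relation.Binary.PropositionalEquality
  using (_≡_; refl; sym; trans; cong; cong₂; subst; module ≡-Reasoning)
open import Relation.Nullary using (¬_; Dec; yes; no)
open import Relation.Unary using (U; _≐_)

module DistanceEnergy where
  open import Algebra.Bundles using (AbelianGroup)
  open import Data.Fin.Properties using (toℕ-fromℕ<; toℕ<n; toℕ-injective)
  open import Data.Integer hiding (suc; _⊖_; _≟_; NonZero)
  open import Data.Integer.DivMod using (a≡a%ℕn+[a/ℕn]*n; n%ℕd<d)
  open import Data.Integer.Divisibility.Signed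
  open import Data.Integer.Properties hiding (_≟_)
  open import Data.Integer.Tactic.RingSolver using (solve-∀)
  open import Data.List using (_++_; map; tabulate; allFin; cartesianProductWith)
  open import Data.List.Membership.Propositional.Properties
    using (∈-∃++; ∈-++⁻; ∈-++⁺ˡ; ∈-++⁺ʳ; ∈-cartesianProductWith⁺; ∈-allFin)
  open import Data.List.Properties using (map-tabulate; length-tabulate)
  open import Data.List.Relation.Unary.All using (lookup)
  open import Data.List.Relation.Unary.AllPairs using ([]; _∷_)
  import Data.Nat.Divisibility as ℕ
  import Data.Nat.DivMod as ℕ
  import Data.Nat.Properties as ℕ
  open import Data.Nat.Coprimality using (Coprime; coprime-Bézout)
  open import Data.Nat.GCD using (module Bézout)
  open import Data.Nat.Tactic.RingSolver using () renaming (solve-∀ to solveℕ-∀)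
  open import Data.Sum using (_⊎_; inj₁; inj₂)
  open import Data.Vec as Vec using (Vec; []; _∷_; zipWith)
  open import Algebra.Properties.Group (AbelianGroup.group +-0-abelianGroup) using (∙-cancelˡ)

  -- Sums over lists and ranges

  private variable
    A B : Set

  ∑ : List A → (A → ℤ) → ℤ
  ∑ []       f = 0ℤ
  ∑ (x ∷ xs) f = f x + ∑ xs f

  ∑-mono-∈ : ∀ (xs : List A) {f g : A → ℤ} → (∀ x → x ∈ xs → f x ≤ g x) → ∑ xs f ≤ ∑ xs g
  ∑-mono-∈ []       f≤g = ≤-refl
  ∑-mono-∈ (x ∷ xs) f≤g = +-mono-≤ (f≤g x (here refl)) (∑-mono-∈ xs (λ y → f≤g y ∘ there))

  ∑-mono : ∀ (xs : List A) {f g : A → ℤ} → (∀ x → f x ≤ g x) → ∑ xs f ≤ ∑ xs g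
  ∑-mono xs f≤g = ∑-mono-∈ xs (λ x _ → f≤g x)

  ∑-cong-∈ : ∀ (xs : List A) {f g : A → ℤ} → (∀ x → x ∈ xs → f x ≡ g x) → ∑ xs f ≡ ∑ xs g
  ∑-cong-∈ []       f≡g = refl
  ∑-cong-∈ (x ∷ xs) f≡g = cong₂ _+_ (f≡g x (here refl)) (∑-cong-∈ xs (λ y → f≡g y ∘ there))

  ∑-cong : ∀ (xs : List A) {f g : A → ℤ} → (∀ x → f x ≡ g x) → ∑ xs f ≡ ∑ xs g
  ∑-cong xs f≡g = ∑-cong-∈ xs (λ x _ → f≡g x)

  ∑-const : ∀ (xs : List A) c → ∑ xs (λ _ → c) ≡ + length xs * c
  ∑-const []       c = refl
  ∑-const (x ∷ xs) c = trans (cong (_+_ c) (∑-const xs c)) (sym (suc-* (+ length xs) c))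

  ∑-zero : ∀ (xs : List A) {f : A → ℤ} → (∀ x → f x ≡ 0ℤ) → ∑ xs f ≡ 0ℤ
  ∑-zero xs f≡0 = trans (∑-cong xs f≡0) (trans (∑-const xs 0ℤ) (*-zeroʳ (+ length xs)))

  ∑-nonneg : ∀ (xs : List A) {f : A → ℤ} → (∀ x → 0ℤ ≤ f x) → 0ℤ ≤ ∑ xs f
  ∑-nonneg xs 0≤f = ≤-trans (≤-reflexive (sym (∑-zero xs (λ _ → refl)))) (∑-mono xs 0≤f)

  interchange : ∀ (a b c d : ℤ) → (a + b) + (c + d) ≡ (a + c) + (b + d)
  interchange = solve-∀

  ∑-+ : ∀ (xs : List A) (f g : A → ℤ) → ∑ xs (λ x → f x + g x) ≡ ∑ xs f + ∑ xs g
  ∑-+ []       f g = refl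
  ∑-+ (x ∷ xs) f g = trans (cong (_+_ (f x + g x)) (∑-+ xs f g)) (interchange (f x) (g x) _ _)

  ∑-*ˡ : ∀ c (xs : List A) (f : A → ℤ) → ∑ xs (λ x → c * f x) ≡ c * ∑ xs f
  ∑-*ˡ c []       f = sym (*-zeroʳ c)
  ∑-*ˡ c (x ∷ xs) f = trans (cong (_+_ (c * f x)) (∑-*ˡ c xs f)) (sym (*-distribˡ-+ c (f x) _))

  ∑-- : ∀ (xs : List A) (f g : A → ℤ) → ∑ xs (λ x → f x - g x) ≡ ∑ xs f - ∑ xs g
  ∑-- []       f g = refl
  ∑-- (x ∷ xs) f g = trans (cong (_+_ (f x - g x)) (∑-- xs f g)) (rearrange (f x) (g x) (∑ xs f) (∑ xs g))
    where
    rearrange : ∀ (a b s t : ℤ) → (a - b) + (s - t) ≡ (a + s) - (b + t)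
    rearrange = solve-∀

  ∑-*ʳ : ∀ (xs : List A) (f : A → ℤ) c → ∑ xs (λ x → f x * c) ≡ ∑ xs f * c
  ∑-*ʳ xs f c = trans (∑-cong xs (λ x → *-comm (f x) c)) (trans (∑-*ˡ c xs f) (*-comm c _))

  ∑-swap : ∀ (xs : List A) (ys : List B) (f : A → B → ℤ) →
           ∑ xs (λ x → ∑ ys (f x)) ≡ ∑ ys (λ y → ∑ xs (λ x → f x y))
  ∑-swap []       ys f = sym (∑-zero ys (λ _ → refl))
  ∑-swap (x ∷ xs) ys f = trans (cong (_+_ (∑ ys (f x))) (∑-swap xs ys f))
                               (sym (∑-+ ys (f x) (λ y → ∑ xs (λ x′ → f x′ y))))

  ∑-++ : ∀ (xs ys : List A) f → ∑ (xs ++ ys) f ≡ ∑ xs f + ∑ ys f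
  ∑-++ []       ys f = sym (+-identityˡ _)
  ∑-++ (x ∷ xs) ys f = trans (cong (_+_ (f x)) (∑-++ xs ys f)) (sym (+-assoc (f x) _ _))

  ∑-map : ∀ (g : A → B) (xs : List A) f → ∑ (map g xs) f ≡ ∑ xs (f ∘ g)
  ∑-map g []       f = refl
  ∑-map g (x ∷ xs) f = cong (_+_ (f (g x))) (∑-map g xs f)

  ∑-cartesianProductWith : ∀ {C : Set} (g : A → B → C) (xs : List A) (ys : List B) f →
    ∑ (cartesianProductWith g xs ys) f ≡ ∑ xs (λ x → ∑ ys (λ y → f (g x y)))
  ∑-cartesianProductWith g []       ys f = refl
  ∑-cartesianProductWith g (x ∷ xs) ys f = trans (∑-++ (map (g x) ys) _ f)
    (cong₂ _+_ (∑-map (g x) ys f) (∑-cartesianProductWith g xs ys f))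

  ∑-*-∑ : ∀ (xs : List A) (ys : List B) f g →
          ∑ xs f * ∑ ys g ≡ ∑ xs (λ x → ∑ ys (λ y → f x * g y))
  ∑-*-∑ xs ys f g = trans (sym (∑-*ʳ xs f (∑ ys g))) (∑-cong xs (λ x → sym (∑-*ˡ (f x) ys g)))

  -- Induction on `xs`: one occurrence of its head is cut out of `ys`, and uniqueness keeps the tail
  -- inside what remains. The leftover terms of `ys` are nonnegative.
  ∑-⊆ : ∀ {xs : List A} (ys : List A) {f : A → ℤ} → Unique xs → (∀ x → x ∈ xs → x ∈ ys) →
        (∀ x → 0ℤ ≤ f x) → ∑ xs f ≤ ∑ ys f
  ∑-⊆ ys [] xs⊆ys 0≤f = ∑-nonneg ys 0≤f
  ∑-⊆ {xs = x ∷ xs} ys {f} (x∉xs ∷ unique) xs⊆ys 0≤f with ∈-∃++ (xs⊆ys x (here refl))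
  ... | as , bs , refl = begin
    f x + ∑ xs f                ≤⟨ +-monoʳ-≤ (f x) (∑-⊆ (as ++ bs) unique xs⊆as++bs 0≤f) ⟩
    f x + ∑ (as ++ bs) f        ≡⟨ cong (_+_ (f x)) (∑-++ as bs f) ⟩
    f x + (∑ as f + ∑ bs f)     ≡⟨ rearrange (f x) (∑ as f) (∑ bs f) ⟩
    ∑ as f + (f x + ∑ bs f)     ≡⟨ ∑-++ as (x ∷ bs) f ⟨
    ∑ (as ++ x ∷ bs) f          ∎
    where
    open ≤-Reasoning
    rearrange : ∀ (a b c : ℤ) → a + (b + c) ≡ b + (a + c)
    rearrange = solve-∀
    xs⊆as++bs : ∀ y → y ∈ xs → y ∈ as ++ bs
    xs⊆as++bs y y∈xs with ∈-++⁻ as (xs⊆ys y (there y∈xs))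
    ... | inj₁ y∈as         = ∈-++⁺ˡ y∈as
    ... | inj₂ (here y≡x)   = ⊥-elim (lookup x∉xs y∈xs (sym y≡x))
    ... | inj₂ (there y∈bs) = ∈-++⁺ʳ as y∈bs

  -- Encoded through `allFin n`, so that every lemma on list sums applies to ranges, while the
  -- summand stays a function on ℕ.
  ∑< : ℕ → (ℕ → ℤ) → ℤ
  ∑< n f = ∑ (allFin n) (f ∘ toℕ)

  ∑<-suc : ∀ n f → ∑< (suc n) f ≡ f 0 + ∑< n (f ∘ suc)
  ∑<-suc n f = cong (_+_ (f 0)) (begin
    ∑ (tabulate {n = n} Fin.suc) (f ∘ toℕ) 
      ≡⟨ cong (λ is → ∑ is (f ∘ toℕ)) (map-tabulate {n = n} (λ i → i) Fin.suc) ⟨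
    ∑ (map Fin.suc (allFin n)) (f ∘ toℕ)    ≡⟨ ∑-map Fin.suc (allFin n) (f ∘ toℕ) ⟩
    ∑< n (f ∘ suc)                          ∎)
    where open ≡-Reasoning

  ∑<-const : ∀ n c → ∑< n (λ _ → c) ≡ + n * c
  ∑<-const zero    c = refl
  ∑<-const (suc n) c = trans (∑<-suc n (λ _ → c))
    (trans (cong (_+_ c) (∑<-const n c)) (sym (suc-* (+ n) c)))

  ∑<-+ : ∀ m n f → ∑< (m ℕ.+ n) f ≡ ∑< m f + ∑< n (λ i → f (m ℕ.+ i))
  ∑<-+ zero    n f = sym (+-identityˡ _)
  ∑<-+ (suc m) n f = begin
    ∑< (suc m ℕ.+ n) f                                    ≡⟨ ∑<-suc (m ℕ.+ n) f ⟩
    f 0 + ∑< (m ℕ.+ n) (f ∘ suc)                          ≡⟨ cong (_+_ (f 0)) (∑<-+ m n (f ∘ suc)) ⟩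
    f 0 + (∑< m (f ∘ suc) + ∑< n (λ i → f (suc m ℕ.+ i))) ≡⟨ +-assoc (f 0) _ _ ⟨
    f 0 + ∑< m (f ∘ suc) + ∑< n (λ i → f (suc m ℕ.+ i))   ≡⟨ cong (_+ ∑< n (λ i → f (suc m ℕ.+ i))) (∑<-suc m f) ⟨
    ∑< (suc m) f + ∑< n (λ i → f (suc m ℕ.+ i))           ∎
    where open ≡-Reasoning

  ∑<-telescope : ∀ n (a : ℕ → ℤ) → ∑< n (λ k → a (suc k) - a k) ≡ a n - a 0
  ∑<-telescope zero    a = sym (+-inverseʳ (a 0))
  ∑<-telescope (suc n) a = begin
    ∑< (suc n) (λ k → a (suc k) - a k)                         ≡⟨ ∑<-suc n (λ k → a (suc k) - a k) ⟩
    a 1 - a 0 + ∑< n (λ k → a (suc (suc k)) - a (suc k))       ≡⟨ cong (_+_ (a 1 - a 0)) (∑<-telescope n (a ∘ suc)) ⟩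
    a 1 - a 0 + (a (suc n) - a 1)                              ≡⟨ rearrange (a 0) (a 1) (a (suc n)) ⟩
    a (suc n) - a 0                                            ∎
    where
    open ≡-Reasoning
    rearrange : ∀ (x y z : ℤ) → y - x + (z - y) ≡ z - x
    rearrange = solve-∀

  -- Squares and Cauchy-Schwarz

  0≤i² : ∀ i → 0ℤ ≤ i * i
  0≤i² (+ n)    = ≤-trans (+≤+ ℕ.z≤n) (≤-reflexive (pos-* n n))
  0≤i² -[1+ n ] = +≤+ ℕ.z≤n

  2ij≤i²+j² : ∀ i j → i * j + i * j ≤ i * i + j * j
  2ij≤i²+j² i j = 0≤i-j⇒j≤i (≤-trans (0≤i² (i - j)) (≤-reflexive (square i j)))
    where
    square : ∀ (i j : ℤ) → (i - j) * (i - j) ≡ i * i + j * j - (i * j + i * j)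
    square = solve-∀

  -- Cauchy-Schwarz against the constant function 1. A new entry x adds the cross terms 2 f(x) f(y),
  -- each at most f(x)² + f(y)².
  ∑²≤length*∑² : ∀ (xs : List A) f → ∑ xs f * ∑ xs f ≤ + length xs * ∑ xs (λ x → f x * f x)
  ∑²≤length*∑² []       f = ≤-refl
  ∑²≤length*∑² (x ∷ xs) f = begin
    (f x + S) * (f x + S)                       ≡⟨ expand (f x) S ⟩
    f x * f x + (S * f x + S * f x) + S * S      ≤⟨ +-mono-≤ (+-monoʳ-≤ (f x * f x) (cross xs)) (∑²≤length*∑² xs f) ⟩
    f x * f x + (+ length xs * (f x * f x) + Q) + + length xs * Q
                                                ≡⟨ collect (f x * f x) (+ length xs) Q ⟩
    (1ℤ + + length xs) * (f x * f x + Q)        ∎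
    where
    open ≤-Reasoning
    S = ∑ xs f
    Q = ∑ xs (λ y → f y * f y)
    expand : ∀ (a s : ℤ) → (a + s) * (a + s) ≡ a * a + (s * a + s * a) + s * s
    expand = solve-∀
    collect : ∀ (a n q : ℤ) → a + (n * a + q) + n * q ≡ (1ℤ + n) * (a + q)
    collect = solve-∀
    cross : ∀ ys → ∑ ys f * f x + ∑ ys f * f x ≤ + length ys * (f x * f x) + ∑ ys (λ y → f y * f y)
    cross ys = begin
      ∑ ys f * f x + ∑ ys f * f x               ≡⟨ cong₂ _+_ (∑-*ʳ ys f (f x)) (∑-*ʳ ys f (f x)) ⟨
      ∑ ys (λ y → f y * f x) + ∑ ys (λ y → f y * f x)
                                                ≡⟨ ∑-+ ys _ _ ⟨
      ∑ ys (λ y → f y * f x + f y * f x)        ≤⟨ ∑-mono ys (λ y → 2ij≤i²+j² (f y) (f x)) ⟩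
      ∑ ys (λ y → f y * f y + f x * f x)        ≡⟨ ∑-+ ys _ _ ⟩
      ∑ ys (λ y → f y * f y) + ∑ ys (λ y → f x * f x)
                                                ≡⟨ +-comm _ (∑ ys (λ y → f x * f x)) ⟩
      ∑ ys (λ y → f x * f x) + ∑ ys (λ y → f y * f y)
                                                ≡⟨ cong (_+ _) (∑-const ys (f x * f x)) ⟩
      + length ys * (f x * f x) + ∑ ys (λ y → f y * f y) ∎

  -- Functions on residues

  Periodic : ℕ → (ℤ → ℤ) → Set
  Periodic n f = ∀ u → f (u + + n) ≡ f u

  ∑<-cong : ∀ n {f g : ℕ → ℤ} → (∀ i → f i ≡ g i) → ∑< n f ≡ ∑< n g
  ∑<-cong n f≡g = ∑-cong (allFin n) (f≡g ∘ toℕ)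

  -- Completed by f(0), both sides become the sum of f over 0, ..., n; the last term f(n) equals
  -- f(0) by periodicity.
  ∑<-shift-suc : ∀ {n f} → Periodic n f → ∑< n (λ i → f (+ suc i)) ≡ ∑< n (λ i → f (+ i))
  ∑<-shift-suc {n} {f} periodic = ∙-cancelˡ (f 0ℤ) _ _ (begin
    f 0ℤ + ∑< n (λ i → f (+ suc i))                  ≡⟨ ∑<-suc n (f ∘ +_) ⟨
    ∑< (1 ℕ.+ n) (f ∘ +_)                            ≡⟨ cong (λ k → ∑< k (f ∘ +_)) (ℕ.+-comm 1 n) ⟩
    ∑< (n ℕ.+ 1) (f ∘ +_)                            ≡⟨ ∑<-+ n 1 (f ∘ +_) ⟩
    ∑< n (f ∘ +_) + (f (+ (n ℕ.+ 0)) + 0ℤ)           ≡⟨ cong (_+_ (∑< n (f ∘ +_))) last ⟩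
    ∑< n (f ∘ +_) + f 0ℤ                             ≡⟨ +-comm _ (f 0ℤ) ⟩
    f 0ℤ + ∑< n (f ∘ +_)                             ∎)
    where
    open ≡-Reasoning
    last : f (+ (n ℕ.+ 0)) + 0ℤ ≡ f 0ℤ
    last = trans (+-identityʳ _) (trans (cong (f ∘ +_) (ℕ.+-comm n 0)) (periodic 0ℤ))

  -- Induction on c towards 0 from either side; `step` is the unit shift applied to the translate of
  -- f by c.
  ∑<-shift : ∀ {n f} → Periodic n f → ∀ c → ∑< n (λ i → f (c + + i)) ≡ ∑< n (λ i → f (+ i))
  ∑<-shift {n} {f} periodic = shift
    where
    S : ℤ → ℤ
    S c = ∑< n (λ i → f (c + + i))

    step : ∀ c → ∑< n (λ i → f (c + + suc i)) ≡ S c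
    step c = ∑<-shift-suc {n} {λ u → f (c + u)} λ u →
      trans (cong f (sym (+-assoc c u (+ n)))) (periodic (c + u))

    shift : ∀ c → S c ≡ S 0ℤ
    shift (+ zero)      = refl
    shift (+ suc k)     = begin
      S (+ suc k)                       ≡⟨ ∑<-cong n (λ i → cong (f ∘ +_) (ℕ.+-suc k i)) ⟨
      ∑< n (λ i → f (+ k + + suc i))    ≡⟨ step (+ k) ⟩
      S (+ k)                           ≡⟨ shift (+ k) ⟩
      S 0ℤ                              ∎
      where open ≡-Reasoning
    shift -[1+ zero ]   = trans (sym (step -[1+ 0 ])) (∑<-cong n (λ i → cong f ([1+m]⊖[1+n]≡m⊖n i 0)))
    shift -[1+ suc k ]  = begin
      S -[1+ suc k ]                             ≡⟨ step -[1+ suc k ] ⟨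
      ∑< n (λ i → f (-[1+ suc k ] + + suc i))    ≡⟨ ∑<-cong n (λ i → cong f ([1+m]⊖[1+n]≡m⊖n i (suc k))) ⟩
      S -[1+ k ]                                 ≡⟨ shift -[1+ k ] ⟩
      S 0ℤ                                       ∎
      where open ≡-Reasoning

  ∑<-multiple : ∀ {m f} → Periodic m f → ∀ r → ∑< (r ℕ.* m) (λ i → f (+ i)) ≡ + r * ∑< m (λ i → f (+ i))
  ∑<-multiple         periodic zero    = refl
  ∑<-multiple {m} {f} periodic (suc r) = begin
    ∑< (m ℕ.+ r ℕ.* m) (λ i → f (+ i))                          ≡⟨ ∑<-+ m (r ℕ.* m) (f ∘ +_) ⟩
    S + ∑< (r ℕ.* m) (λ i → f (+ (m ℕ.+ i)))                    ≡⟨ cong (_+_ S) (∑<-cong (r ℕ.* m) back) ⟩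
    S + ∑< (r ℕ.* m) (λ i → f (+ i))                            ≡⟨ cong (_+_ S) (∑<-multiple periodic r) ⟩
    S + + r * S                                                 ≡⟨ suc-* (+ r) S ⟨
    + suc r * S                                                 ∎
    where
    open ≡-Reasoning
    S = ∑< m (λ i → f (+ i))
    back : ∀ i → f (+ (m ℕ.+ i)) ≡ f (+ i)
    back i = trans (cong (f ∘ +_) (ℕ.+-comm m i)) (periodic (+ i))

  -- Once the period is shifted to begin at u, f(u) is its first term and the others are
  -- nonnegative.
  ≤∑<-periodic : ∀ {n f} .{{_ : ℕ.NonZero n}} → Periodic n f → (∀ u → 0ℤ ≤ f u) →
                 ∀ u → f u ≤ ∑< n (λ i → f (+ i))
  ≤∑<-periodic {suc n} {f} periodic 0≤f u = begin
    f u                                              ≡⟨ cong f (+-identityʳ u) ⟨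
    f (u + 0ℤ)                                       ≡⟨ +-identityʳ _ ⟨
    f (u + 0ℤ) + 0ℤ                                 
      ≤⟨ +-monoʳ-≤ (f (u + 0ℤ)) (∑-nonneg (allFin n) (λ i → 0≤f (u + + suc (toℕ i)))) ⟩
    f (u + 0ℤ) + ∑< n (λ i → f (u + + suc i))        ≡⟨ ∑<-suc n (λ i → f (u + + i)) ⟨
    ∑< (suc n) (λ i → f (u + + i))                   ≡⟨ ∑<-shift {suc n} {f} periodic u ⟩
    ∑< (suc n) (λ i → f (+ i))                       ∎
    where open ≤-Reasoning

  -- Divisibility indicators and the mean-zero function `γ`

  ι : ∀ {P : Set} → Dec P → ℤ
  ι (yes _) = 1ℤ
  ι (no  _) = 0ℤ

  δ : ℕ → ℤ → ℤ
  δ m u = ι (+ m ∣? u)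

  δ-yes : ∀ {m u} → + m ∣ u → δ m u ≡ 1ℤ
  δ-yes {m} {u} m∣u with + m ∣? u
  ... | yes _   = refl
  ... | no  m∤u = ⊥-elim (m∤u m∣u)

  δ-no : ∀ {m u} → ¬ (+ m ∣ u) → δ m u ≡ 0ℤ
  δ-no {m} {u} m∤u with + m ∣? u
  ... | yes m∣u = ⊥-elim (m∤u m∣u)
  ... | no  _   = refl

  δ-cong : ∀ {m n u v} → (+ m ∣ u → + n ∣ v) → (+ n ∣ v → + m ∣ u) → δ m u ≡ δ n v
  δ-cong {m} {n} {u} {v} to from with + m ∣? u
  ... | yes m∣u = sym (δ-yes (to m∣u))
  ... | no  m∤u = sym (δ-no (m∤u ∘ from))

  δ-+ : ∀ {m c} → + m ∣ c → ∀ u → δ m (u + c) ≡ δ m u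
  δ-+ m∣c u = δ-cong (λ m∣u+c → ∣m+n∣n⇒∣m m∣u+c m∣c) (λ m∣u → ∣m∣n⇒∣m+n m∣u m∣c)

  ∑δ≡1 : ∀ m .{{_ : ℕ.NonZero m}} → ∑< m (λ i → δ m (+ i)) ≡ 1ℤ
  ∑δ≡1 (suc m) = begin
    ∑< (suc m) (λ i → δ (suc m) (+ i))                       ≡⟨ ∑<-suc m (λ i → δ (suc m) (+ i)) ⟩
    δ (suc m) 0ℤ + ∑< m (λ i → δ (suc m) (+ suc i))         
      ≡⟨ cong₂ _+_ (δ-yes {suc m} {0ℤ} (divides 0ℤ refl)) (∑-zero (allFin m) small) ⟩
    1ℤ                                                       ∎
    where
    open ≡-Reasoning
    small : ∀ i → δ (suc m) (+ suc (toℕ i)) ≡ 0ℤ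
    small i = δ-no (λ m∣i → ℕ.>⇒∤ (ℕ.s≤s (toℕ<n i)) (∣⇒∣ᵤ m∣i))

  ∑δ : ∀ r m .{{_ : ℕ.NonZero m}} c → ∑< (r ℕ.* m) (λ i → δ m (c + + i)) ≡ + r
  ∑δ r m c = begin
    ∑< (r ℕ.* m) (λ i → δ m (c + + i))    ≡⟨ ∑<-shift {r ℕ.* m} {δ m} (δ-+ (divides (+ r) (pos-* r m))) c ⟩
    ∑< (r ℕ.* m) (λ i → δ m (+ i))        ≡⟨ ∑<-multiple (δ-+ ∣-refl) r ⟩
    + r * ∑< m (λ i → δ m (+ i))          ≡⟨ cong (_*_ (+ r)) (∑δ≡1 m) ⟩
    + r * 1ℤ                              ≡⟨ *-identityʳ (+ r) ⟩
    + r                                   ∎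
    where open ≡-Reasoning

  -- A martingale difference: m · `γ` is the step from m · `δ m` to pm · `δ (p ℕ.* m)`, two
  -- functions of mean 1 over a period pm.
  γ : ℕ → ℕ → ℤ → ℤ
  γ p m u = + p * δ (p ℕ.* m) u - δ m u

  +m∣+pm : ∀ p m → + m ∣ + (p ℕ.* m)
  +m∣+pm p m = divides (+ p) (pos-* p m)

  γ-+ : ∀ {p m c} → + (p ℕ.* m) ∣ c → ∀ u → γ p m (u + c) ≡ γ p m u
  γ-+ {p} {m} pm∣c u = cong₂ (λ a b → + p * a - b) (δ-+ pm∣c u) (δ-+ (∣-trans (+m∣+pm p m) pm∣c) u)

  -- As multiples of pm are multiples of m, the square of `γ` is (p² - 2p)[pm ∣ u] + [m ∣ u]. A
  -- period contains one multiple of pm and p multiples of m, so the sum is exactly p² - p.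
  ∑γ²≤p² : ∀ p m .{{_ : ℕ.NonZero p}} .{{_ : ℕ.NonZero m}} →
           ∑< (p ℕ.* m) (λ i → γ p m (+ i) * γ p m (+ i)) ≤ + p * + p
  ∑γ²≤p² p m = begin
    ∑< pm (λ i → γ p m (+ i) * γ p m (+ i))
      ≡⟨ ∑<-cong pm (λ i → γ² (+ i)) ⟩
    ∑< pm (λ i → (+ p * + p - (+ p + + p)) * δ pm (+ i) + δ m (+ i))
      ≡⟨ ∑-+ (allFin pm) _ _ ⟩
    ∑< pm (λ i → (+ p * + p - (+ p + + p)) * δ pm (+ i)) + ∑< pm (λ i → δ m (+ i))
      ≡⟨ cong₂ _+_ (∑-*ˡ (+ p * + p - (+ p + + p)) (allFin pm) _) (∑δ p m 0ℤ) ⟩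
    (+ p * + p - (+ p + + p)) * ∑< pm (λ i → δ pm (+ i)) + + p
      ≡⟨ cong (λ s → (+ p * + p - (+ p + + p)) * s + + p) (∑δ≡1 pm {{ℕ.m*n≢0 p m}}) ⟩
    (+ p * + p - (+ p + + p)) * 1ℤ + + p
      ≡⟨ collect (+ p) ⟩
    + p * + p - + p
      ≤⟨ i-j≤i (+ p * + p) (+ p) ⟩
    + p * + p ∎
    where
    open ≤-Reasoning
    pm = p ℕ.* m
    collect : ∀ (x : ℤ) → (x * x - (x + x)) * 1ℤ + x ≡ x * x - x
    collect = solve-∀
    both : ∀ (x : ℤ) → (x * 1ℤ - 1ℤ) * (x * 1ℤ - 1ℤ) ≡ (x * x - (x + x)) * 1ℤ + 1ℤ
    both = solve-∀
    lower : ∀ (x : ℤ) → (x * 0ℤ - 1ℤ) * (x * 0ℤ - 1ℤ) ≡ (x * x - (x + x)) * 0ℤ + 1ℤ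
    lower = solve-∀
    none : ∀ (x : ℤ) → (x * 0ℤ - 0ℤ) * (x * 0ℤ - 0ℤ) ≡ (x * x - (x + x)) * 0ℤ + 0ℤ
    none = solve-∀
    γ² : ∀ u → γ p m u * γ p m u ≡ (+ p * + p - (+ p + + p)) * δ pm u + δ m u
    γ² u with + pm ∣? u | + m ∣? u
    ... | yes _    | yes _   = both (+ p)
    ... | yes pm∣u | no m∤u  = ⊥-elim (m∤u (∣-trans (+m∣+pm p m) pm∣u))
    ... | no _     | yes _   = lower (+ p)
    ... | no _     | no _    = none (+ p)

  -- If m ∤ a, every term vanishes. Otherwise division by m leaves p consecutive integers, exactly
  -- one of them a multiple of p: its contribution p cancels the p terms -1.
  ∑γ-coset : ∀ p m .{{_ : ℕ.NonZero p}} .{{_ : ℕ.NonZero m}} a → ∑< p (λ k → γ p m (a + + m * + k)) ≡ 0ℤ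
  ∑γ-coset p m a with + m ∣? a
  ... | no  m∤a = ∑-zero (allFin p) vanish
    where
    m∤ : ∀ k → ¬ (+ m ∣ a + + m * + k)
    m∤ k m∣ = m∤a (∣m+n∣n⇒∣m m∣ (∣m⇒∣m*n (+ k) ∣-refl))
    vanish : ∀ i → γ p m (a + + m * + toℕ i) ≡ 0ℤ
    vanish i = trans (cong₂ (λ x y → + p * x - y) (δ-no (m∤ (toℕ i) ∘ ∣-trans (+m∣+pm p m)))
                                                  (δ-no (m∤ (toℕ i))))
                     (trans (+-identityʳ (+ p * 0ℤ)) (*-zeroʳ (+ p)))
  ... | yes (divides a′ refl) = begin
    ∑< p (λ k → γ p m (a′ * + m + + m * + k))
      ≡⟨ ∑<-cong p (λ k → cong₂ (λ x y → + p * x - y) (scale k) (δ-yes (m∣ k))) ⟩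
    ∑< p (λ k → + p * δ p (a′ + + k) - 1ℤ)
      ≡⟨ ∑-+ (allFin p) (λ i → + p * δ p (a′ + + toℕ i)) (λ _ → - 1ℤ) ⟩
    ∑< p (λ k → + p * δ p (a′ + + k)) + ∑< p (λ _ → - 1ℤ)
      ≡⟨ cong₂ _+_ (∑-*ˡ (+ p) (allFin p) _) (∑<-const p (- 1ℤ)) ⟩
    + p * ∑< p (λ k → δ p (a′ + + k)) + + p * - 1ℤ
      ≡⟨ cong (λ s → + p * s + + p * - 1ℤ) count ⟩
    + p * 1ℤ + + p * - 1ℤ
      ≡⟨ cancel (+ p) ⟩
    0ℤ ∎
    where
    open ≡-Reasoning
    cancel : ∀ (x : ℤ) → x * 1ℤ + x * - 1ℤ ≡ 0ℤ
    cancel = solve-∀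
    factor : ∀ (x y z : ℤ) → x * y + y * z ≡ (x + z) * y
    factor = solve-∀
    m∣ : ∀ k → + m ∣ a′ * + m + + m * + k
    m∣ k = divides (a′ + + k) (factor a′ (+ m) (+ k))
    scale : ∀ k → δ (p ℕ.* m) (a′ * + m + + m * + k) ≡ δ p (a′ + + k)
    scale k rewrite factor a′ (+ m) (+ k) = δ-cong
      (λ pm∣ → *-cancelʳ-∣ (+ m) (subst (_∣ (a′ + + k) * + m) (pos-* p m) pm∣))
      (λ p∣ → subst (_∣ (a′ + + k) * + m) (sym (pos-* p m)) (*-monoˡ-∣ (+ m) p∣))
    count : ∑< p (λ k → δ p (a′ + + k)) ≡ 1ℤ
    count = trans (cong (λ n → ∑< n (λ k → δ p (a′ + + k))) (sym (ℕ.*-identityˡ p))) (∑δ 1 p a′)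

  -- The shift i ↦ i + c moves b * i + e by m modulo p m, so averaging over the shifts
  -- by c k, k < p, replaces γ by its sum over a coset.
  ∑γ-linear : ∀ {p m q} .{{_ : ℕ.NonZero p}} .{{_ : ℕ.NonZero m}} → + (p ℕ.* m) ∣ + q →
              ∀ b c → + (p ℕ.* m) ∣ b * c - + m → ∀ e → ∑< q (λ i → γ p m (b * + i + e)) ≡ 0ℤ
  ∑γ-linear {p} {m} {q} pm∣q b c bc≡m e = *-cancelˡ-≡ (+ p) S 0ℤ (begin
    + p * S                                                       ≡⟨ ∑<-const p S ⟨
    ∑< p (λ _ → S)                                                ≡⟨ ∑<-cong p (λ k → ∑<-shift periodic (c * + k)) ⟨
    ∑< p (λ k → ∑< q (λ i → γ p m (b * (c * + k + + i) + e)))     ≡⟨ ∑<-cong p (λ k → ∑<-cong q (λ i → coset k i)) ⟩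
    ∑< p (λ k → ∑< q (λ i → γ p m (b * + i + e + + m * + k)))     ≡⟨ ∑-swap (allFin p) (allFin q) _ ⟩
    ∑< q (λ i → ∑< p (λ k → γ p m (b * + i + e + + m * + k)))    
      ≡⟨ ∑-zero (allFin q) (λ i → ∑γ-coset p m (b * + toℕ i + e)) ⟩
    0ℤ                                                            ≡⟨ *-zeroʳ (+ p) ⟨
    + p * 0ℤ                                                      ∎)
    where
    open ≡-Reasoning
    f : ℤ → ℤ
    f u = γ p m (b * u + e)
    S = ∑< q (λ i → f (+ i))
    shift-arg : ∀ (b u v e : ℤ) → b * (u + v) + e ≡ b * u + e + b * v
    shift-arg = solve-∀
    periodic : Periodic q f
    periodic u = trans (cong (γ p m) (shift-arg b u (+ q) e))
                       (γ-+ {p} {m} (∣n⇒∣m*n b pm∣q) (b * u + e))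
    split : ∀ (b c k i e m : ℤ) → b * (c * k + i) + e ≡ (b * i + e + m * k) + (b * c - m) * k
    split = solve-∀
    coset : ∀ k i → γ p m (b * (c * + k + + i) + e) ≡ γ p m (b * + i + e + + m * + k)
    coset k i = trans (cong (γ p m) (split b c (+ k) (+ i) e (+ m)))
                      (γ-+ {p} {m} (∣m⇒∣m*n (+ k) bc≡m) (b * + i + e + + m * + k))

  -- Linear congruences modulo prime powers

  unit-inverse : ∀ {p} → Prime p → ∀ b → ¬ (+ p ∣ b) → ∃ λ c → + p ∣ b * c - 1ℤ
  unit-inverse {p} p-prime b p∤b with m∣∣m∣ {b} | coprime-Bézout coprime
    where
    coprime : Coprime p ∣ b ∣
    coprime {d} (d∣p , d∣b) with prime⇒irreducible p-prime d∣p
    ... | inj₁ d≡1 = d≡1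
    ... | inj₂ refl = ⊥-elim (p∤b (∣ᵤ⇒∣ d∣b))
  -- Bézout is applied to |b| = s b, so `s` carries the sign of b. Here 1 + y|b| = x p, whence the
  -- minus sign in the inverse -y s; in the other case the inverse is y s.
  ... | divides s ∣b∣≡sb | Bézout.+- x y 1+yb≡xp = - (+ y * s) , divides (- + x) (begin
    b * - (+ y * s) - 1ℤ        ≡⟨ rearrange b (+ y) s ⟩
    - (1ℤ + + y * (s * b))      ≡⟨ cong (λ z → - (1ℤ + + y * z)) ∣b∣≡sb ⟨
    - (1ℤ + + y * + ∣ b ∣)      ≡⟨ cong (λ z → - (1ℤ + z)) (pos-* y ∣ b ∣) ⟨
    - (+ (1 ℕ.+ y ℕ.* ∣ b ∣))   ≡⟨ cong (λ z → - (+ z)) 1+yb≡xp ⟩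
    - (+ (x ℕ.* p))             ≡⟨ cong -_ (pos-* x p) ⟩
    - (+ x * + p)               ≡⟨ neg-distribˡ-* (+ x) (+ p) ⟩
    - + x * + p                 ∎)
    where
    open ≡-Reasoning
    rearrange : ∀ (b y s : ℤ) → b * - (y * s) - 1ℤ ≡ - (1ℤ + y * (s * b))
    rearrange = solve-∀
  ... | divides s ∣b∣≡sb | Bézout.-+ x y 1+xp≡yb = + y * s , divides (+ x) (begin
    b * (+ y * s) - 1ℤ          ≡⟨ rearrange b (+ y) s ⟩
    + y * (s * b) - 1ℤ          ≡⟨ cong (λ z → + y * z - 1ℤ) ∣b∣≡sb ⟨
    + y * + ∣ b ∣ - 1ℤ          ≡⟨ cong (_- 1ℤ) (pos-* y ∣ b ∣) ⟨
    + (y ℕ.* ∣ b ∣) - 1ℤ        ≡⟨ cong (λ z → + z - 1ℤ) 1+xp≡yb ⟨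
    1ℤ + + (x ℕ.* p) - 1ℤ       ≡⟨ cong (λ z → 1ℤ + z - 1ℤ) (pos-* x p) ⟩
    1ℤ + + x * + p - 1ℤ         ≡⟨ cancel (+ x * + p) ⟩
    + x * + p                   ∎)
    where
    open ≡-Reasoning
    rearrange : ∀ (b y s : ℤ) → b * (y * s) - 1ℤ ≡ y * (s * b) - 1ℤ
    rearrange = solve-∀
    cancel : ∀ (z : ℤ) → 1ℤ + z - 1ℤ ≡ z
    cancel = solve-∀

  -- Supplies the shift c that `∑γ-linear` requires. If p ∤ b, an inverse of b modulo p is
  -- multiplied by pᵏ. If p ∣ b, one factor p cancels from b, the target and the modulus, and k
  -- drops by one; at k = 0 this case contradicts the hypothesis.
  solve-top-digit : ∀ {p} → Prime p → ∀ k b → ¬ (+ (p ℕ.^ suc k) ∣ b) →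
                    ∃ λ c → + (p ℕ.^ suc k) ∣ b * c - + (p ℕ.^ k)
  solve-top-digit {p} p-prime k b pᵏ⁺¹∤b with + p ∣? b
  solve-top-digit {p} p-prime k b pᵏ⁺¹∤b | no p∤b with unit-inverse p-prime b p∤b
  ... | c , divides x bc-1≡xp = c * + (p ℕ.^ k) , divides x (begin
    b * (c * m) - m     ≡⟨ rearrange b c m ⟩
    (b * c - 1ℤ) * m    ≡⟨ cong (_* m) bc-1≡xp ⟩
    x * + p * m         ≡⟨ *-assoc x (+ p) m ⟩
    x * (+ p * m)       ≡⟨ cong (_*_ x) (pos-* p (p ℕ.^ k)) ⟨
    x * + (p ℕ.^ suc k) ∎)
    where
    open ≡-Reasoning
    m = + (p ℕ.^ k)
    rearrange : ∀ (b c m : ℤ) → b * (c * m) - m ≡ (b * c - 1ℤ) * m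
    rearrange = solve-∀
  solve-top-digit {p} p-prime zero    b p∤b | yes p∣b =
    ⊥-elim (p∤b (subst (λ n → + n ∣ b) (sym (ℕ.*-identityʳ p)) p∣b))
  solve-top-digit {p} p-prime (suc k) _ pᵏ⁺²∤b | yes (divides b refl)
    with solve-top-digit p-prime k b (λ { (divides x refl) → pᵏ⁺²∤b (divides x (lower x)) })
    where
    lower : ∀ x → x * + (p ℕ.^ suc k) * + p ≡ x * + (p ℕ.^ suc (suc k))
    lower x = trans (*-assoc x _ (+ p)) (cong (_*_ x) (trans (*-comm _ (+ p)) (sym (pos-* p _))))
  ... | c , divides x bc-m≡xn = c , divides x (begin
    b * + p * c - + (p ℕ.* m)          ≡⟨ cong (λ z → b * + p * c - z) (pos-* p m) ⟩
    b * + p * c - + p * + m            ≡⟨ rearrange b (+ p) c (+ m) ⟩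
    + p * (b * c - + m)                ≡⟨ cong (_*_ (+ p)) bc-m≡xn ⟩
    + p * (x * + (p ℕ.* m))            ≡⟨ *-left (+ p) x (+ (p ℕ.* m)) ⟩
    x * (+ p * + (p ℕ.* m))            ≡⟨ cong (_*_ x) (pos-* p (p ℕ.* m)) ⟨
    x * + (p ℕ.* (p ℕ.* m))            ∎)
    where
    open ≡-Reasoning
    m = p ℕ.^ k
    rearrange : ∀ (b p c m : ℤ) → b * p * c - p * m ≡ p * (b * c - m)
    rearrange = solve-∀
    *-left : ∀ (a b c : ℤ) → a * (b * c) ≡ b * (a * c)
    *-left = solve-∀

  -- The second moment over a box

  box : ∀ q d → List (Vec (Fin q) d)
  box q zero    = [] ∷ []
  box q (suc d) = cartesianProductWith _∷_ (allFin q) (box q d)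

  ∈-box : ∀ {q d} (v : Vec (Fin q) d) → v ∈ box q d
  ∈-box []      = here refl
  ∈-box (i ∷ v) = ∈-cartesianProductWith⁺ _∷_ (∈-allFin i) (∈-box v)

  ∑-box-suc : ∀ q d f → ∑ (box q (suc d)) f ≡ ∑ (allFin q) (λ i → ∑ (box q d) (λ v → f (i ∷ v)))
  ∑-box-suc q d f = ∑-cartesianProductWith _∷_ (allFin q) (box q d) f

  ∑-box-const : ∀ q d c → ∑ (box q d) (λ _ → c) ≡ + (q ℕ.^ d) * c
  ∑-box-const q zero    c = trans (+-identityʳ c) (sym (*-identityˡ c))
  ∑-box-const q (suc d) c = begin
    ∑ (box q (suc d)) (λ _ → c)            ≡⟨ ∑-box-suc q d (λ _ → c) ⟩
    ∑< q (λ _ → ∑ (box q d) (λ _ → c))     ≡⟨ ∑<-const q (∑ (box q d) (λ _ → c)) ⟩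
    + q * ∑ (box q d) (λ _ → c)            ≡⟨ cong (_*_ (+ q)) (∑-box-const q d c) ⟩
    + q * (+ (q ℕ.^ d) * c)                ≡⟨ *-assoc (+ q) _ c ⟨
    + q * + (q ℕ.^ d) * c                  ≡⟨ cong (_* c) (pos-* q (q ℕ.^ d)) ⟨
    + (q ℕ.^ suc d) * c                    ∎
    where open ≡-Reasoning

  ⟦_⟧ : ∀ {q d} → Vec (Fin q) d → Vec ℤ d
  ⟦_⟧ = Vec.map (λ i → + toℕ i)

  infix 8 _∙_
  -- The left argument has integer entries because it will also be a difference of lifts; the right
  -- one runs over the box.
  _∙_ : ∀ {q d} → Vec ℤ d → Vec (Fin q) d → ℤ
  []      ∙ []      = 0ℤ
  (b ∷ β) ∙ (i ∷ v) = b * + toℕ i + β ∙ v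

  _-ᶻ_ : ∀ {d} → Vec ℤ d → Vec ℤ d → Vec ℤ d
  _-ᶻ_ = zipWith _-_

  ∙-distribʳ-- : ∀ {q d} (α β : Vec ℤ d) (v : Vec (Fin q) d) → (α -ᶻ β) ∙ v ≡ α ∙ v - β ∙ v
  ∙-distribʳ-- []      []      []      = refl
  ∙-distribʳ-- (a ∷ α) (b ∷ β) (i ∷ v) =
    trans (cong (_+_ ((a - b) * + toℕ i)) (∙-distribʳ-- α β v))
          (distrib a b (+ toℕ i) (α ∙ v) (β ∙ v))
    where
    distrib : ∀ (a b i x y : ℤ) → (a - b) * i + (x - y) ≡ a * i + x - (b * i + y)
    distrib = solve-∀

  χ : ∀ {d} → ℕ → Vec ℤ d → ℤ
  χ n []      = 1ℤ
  χ n (b ∷ β) = δ n b * χ n β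

  χ≡0⊎χ≡1 : ∀ n {d} (β : Vec ℤ d) → χ n β ≡ 0ℤ ⊎ χ n β ≡ 1ℤ
  χ≡0⊎χ≡1 n []      = inj₂ refl
  χ≡0⊎χ≡1 n (b ∷ β) with + n ∣? b
  ... | no  _ = inj₁ refl
  ... | yes _ with χ≡0⊎χ≡1 n β
  ...   | inj₁ χ≡0 = inj₁ (trans (*-identityˡ (χ n β)) χ≡0)
  ...   | inj₂ χ≡1 = inj₂ (trans (*-identityˡ (χ n β)) χ≡1)

  0≤χ : ∀ n {d} (β : Vec ℤ d) → 0ℤ ≤ χ n β
  0≤χ n β with χ≡0⊎χ≡1 n β
  ... | inj₁ χ≡0 = ≤-reflexive (sym χ≡0)
  ... | inj₂ χ≡1 = ≤-trans (+≤+ ℕ.z≤n) (≤-reflexive (sym χ≡1))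

  -- The sum factors over the coordinates, and r of the q = r n values of each coordinate lie in the
  -- prescribed class modulo n.
  ∑χ : ∀ {r n q d} .{{_ : ℕ.NonZero n}} → q ≡ r ℕ.* n → ∀ α →
       ∑ (box q d) (λ v → χ n (α -ᶻ ⟦ v ⟧)) ≡ + (r ℕ.^ d)
  ∑χ                 q≡rn []      = refl
  ∑χ {r} {n} {q} {suc d} q≡rn (a ∷ α) = begin
    ∑ (box q (suc d)) (λ v → χ n ((a ∷ α) -ᶻ ⟦ v ⟧))
      ≡⟨ ∑-box-suc q d (λ v → χ n ((a ∷ α) -ᶻ ⟦ v ⟧)) ⟩
    ∑ (allFin q) (λ i → ∑ (box q d) (λ v → δ n (a - + toℕ i) * χ n (α -ᶻ ⟦ v ⟧)))
      ≡⟨ ∑-*-∑ (allFin q) (box q d) (λ i → δ n (a - + toℕ i)) (λ v → χ n (α -ᶻ ⟦ v ⟧)) ⟨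
    ∑< q (λ i → δ n (a - + i)) * ∑ (box q d) (λ v → χ n (α -ᶻ ⟦ v ⟧))
      ≡⟨ cong₂ _*_ count (∑χ {r} {n} {q} {d} q≡rn α) ⟩
    + r * + (r ℕ.^ d)
      ≡⟨ pos-* r (r ℕ.^ d) ⟨
    + (r ℕ.^ suc d) ∎
    where
    open ≡-Reasoning
    negated : ∀ (a i : ℤ) → - (a - i) ≡ - a + i
    negated = solve-∀
    negated′ : ∀ (a i : ℤ) → - (- a + i) ≡ a - i
    negated′ = solve-∀
    -- The sign is changed to reach the form c + i of `∑δ`.
    flip : ∀ i → δ n (a - + i) ≡ δ n (- a + + i)
    flip i = δ-cong (λ n∣ → subst (+ n ∣_) (negated a (+ i)) (∣m⇒∣-m n∣))
                    (λ n∣ → subst (+ n ∣_) (negated′ a (+ i)) (∣m⇒∣-m n∣))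
    count : ∑< q (λ i → δ n (a - + i)) ≡ + r
    count = begin
      ∑< q (λ i → δ n (a - + i))              ≡⟨ ∑<-cong q flip ⟩
      ∑< q (λ i → δ n (- a + + i))            ≡⟨ cong (λ k → ∑< k (λ i → δ n (- a + + i))) q≡rn ⟩
      ∑< (r ℕ.* n) (λ i → δ n (- a + + i))    ≡⟨ ∑δ r n (- a) ⟩
      + r                                     ∎

  -- Isolates what the second moment asks of the coefficient c of x·y. It is later proved for c =
  -- -2, and the oddness of q enters only there.
  Balanced : (p m q : ℕ) (c : ℤ) → Set
  Balanced p m q c = ∀ b → ¬ (+ (p ℕ.* m) ∣ b) → ∀ e → ∑< q (λ i → γ p m (c * b * + i + e)) ≡ 0ℤ

  -- Some coordinate b of β is not divisible by pm, and summing over that coordinate alone gives 0.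
  -- Divisible coordinates before it are absorbed into e. For the empty vector the hypothesis reads
  -- 1 = 0, so no clause arises.
  ∑γ-box : ∀ {p m q c} → Balanced p m q c →
    ∀ {d} (β : Vec ℤ d) → χ (p ℕ.* m) β ≡ 0ℤ →
    ∀ e → ∑ (box q d) (λ v → γ p m (c * β ∙ v + e)) ≡ 0ℤ
  ∑γ-box {p} {m} {q} {c} balanced {suc d} (b ∷ β) χ≡0 e =
    trans (∑-box-suc q d (λ v → γ p m (c * (b ∷ β) ∙ v + e))) (by-cases (+ (p ℕ.* m) ∣? b) χ≡0)
    where
    open ≡-Reasoning
    first : ∀ (c b i x e : ℤ) → c * (b * i + x) + e ≡ c * b * i + (c * x + e)
    first = solve-∀
    rest : ∀ (c b i x e : ℤ) → c * (b * i + x) + e ≡ c * x + (c * (b * i) + e)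
    rest = solve-∀
    -- Abstracting the decision lets the factor `δ` inside `χ` compute in each branch.
    by-cases : (n∣?b : Dec (+ (p ℕ.* m) ∣ b)) → ι n∣?b * χ (p ℕ.* m) β ≡ 0ℤ →
               ∑ (allFin q) (λ i → ∑ (box q d) (λ v → γ p m (c * (b * + toℕ i + β ∙ v) + e))) ≡ 0ℤ
    by-cases (yes _) χβ≡0 = ∑-zero (allFin q) λ i → begin
      ∑ (box q d) (λ v → γ p m (c * (b * + toℕ i + β ∙ v) + e))
        ≡⟨ ∑-cong (box q d) (λ v → cong (γ p m) (rest c b (+ toℕ i) (β ∙ v) e)) ⟩
      ∑ (box q d) (λ v → γ p m (c * β ∙ v + (c * (b * + toℕ i) + e)))
        ≡⟨ ∑γ-box {p} {m} {q} {c} balanced β (trans (sym (*-identityˡ _)) χβ≡0) (c * (b * + toℕ i) + e) ⟩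
      0ℤ ∎
    by-cases (no n∤b) _ = begin
      ∑ (allFin q) (λ i → ∑ (box q d) (λ v → γ p m (c * (b * + toℕ i + β ∙ v) + e)))
        ≡⟨ ∑-swap (allFin q) (box q d) (λ i v → γ p m (c * (b * + toℕ i + β ∙ v) + e)) ⟩
      ∑ (box q d) (λ v → ∑< q (λ i → γ p m (c * (b * + i + β ∙ v) + e)))
        ≡⟨ ∑-cong (box q d) (λ v → ∑<-cong q (λ i → cong (γ p m) (first c b (+ i) (β ∙ v) e))) ⟩
      ∑ (box q d) (λ v → ∑< q (λ i → γ p m (c * b * + i + (c * β ∙ v + e))))
        ≡⟨ ∑-zero (box q d) (λ v → balanced b n∤b (c * β ∙ v + e)) ⟩
      0ℤ ∎

  -- The cross term of two points in the expanded square: α and β will be their lifts, w and w′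
  -- their integer norms.
  correlation : ∀ (p m q : ℕ) (c : ℤ) {d} (α β : Vec ℤ d) (w w′ : ℤ) → ℤ
  correlation p m q c {d} α β w w′ = ∑ (box q d) λ v →
    ∑< (p ℕ.* m) λ s → γ p m (c * α ∙ v + w + + s) * γ p m (c * β ∙ v + w′ + + s)

  i+i≤j+j⇒i≤j : ∀ {i j} → i + i ≤ j + j → i ≤ j
  i+i≤j+j⇒i≤j {i} {j} 2i≤2j with i ≤? j
  ... | yes i≤j = i≤j
  ... | no  i≰j = ⊥-elim (<⇒≱ (+-mono-< (≰⇒> i≰j) (≰⇒> i≰j)) 2i≤2j)

  γ-periodic : ∀ p m a → Periodic (p ℕ.* m) (λ u → γ p m (a + u))
  γ-periodic p m a u = trans (cong (γ p m) (sym (+-assoc a u (+ (p ℕ.* m))))) (γ-+ {p} {m} ∣-refl (a + u))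

  -- 2fg ≤ f² + g² reduces the product to two sums of squares, each shift-invariant and hence at
  -- most p².
  ∑γγ≤p² : ∀ p m .{{_ : ℕ.NonZero p}} .{{_ : ℕ.NonZero m}} a b →
           ∑< (p ℕ.* m) (λ s → γ p m (a + + s) * γ p m (b + + s)) ≤ + p * + p
  ∑γγ≤p² p m a b = i+i≤j+j⇒i≤j (begin
    ∑< n (λ s → f s * g s) + ∑< n (λ s → f s * g s)  ≡⟨ ∑-+ (allFin n) _ _ ⟨
    ∑< n (λ s → f s * g s + f s * g s)               ≤⟨ ∑-mono (allFin n) (λ s → 2ij≤i²+j² (f (toℕ s)) (g (toℕ s))) ⟩
    ∑< n (λ s → f s * f s + g s * g s)               ≡⟨ ∑-+ (allFin n) _ _ ⟩
    ∑< n (λ s → f s * f s) + ∑< n (λ s → g s * g s)  ≤⟨ +-mono-≤ (square a) (square b) ⟩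
    + p * + p + + p * + p                            ∎)
    where
    open ≤-Reasoning
    n = p ℕ.* m
    f g : ℕ → ℤ
    f s = γ p m (a + + s)
    g s = γ p m (b + + s)
    square : ∀ a → ∑< n (λ s → γ p m (a + + s) * γ p m (a + + s)) ≤ + p * + p
    square a = ≤-trans (≤-reflexive (∑<-shift {n} {λ u → γ p m u * γ p m u}
      (λ u → cong₂ _*_ (γ-+ {p} {m} ∣-refl u) (γ-+ {p} {m} ∣-refl u)) a)) (∑γ²≤p² p m)

  -- When α ≢ β (mod p m), the substitution s ↦ s − (c β·v + w′) makes the second factor
  -- independent of v, and the first factor then sums to zero over the box.
  correlation≤ : ∀ {p m q c} .{{_ : ℕ.NonZero p}} .{{_ : ℕ.NonZero m}} →
    Balanced p m q c →
    ∀ {d} (α β : Vec ℤ d) w w′ →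
    correlation p m q c α β w w′ ≤ + (q ℕ.^ d) * (+ p * + p) * χ (p ℕ.* m) (α -ᶻ β)
  correlation≤ {p} {m} {q} {c} balanced {d} α β w w′ with χ≡0⊎χ≡1 (p ℕ.* m) (α -ᶻ β)
  -- For congruent vectors no cancellation is sought: each v contributes at most p².
  ... | inj₂ χ≡1 = begin
    correlation p m q c α β w w′   ≤⟨ ∑-mono (box q d) (λ v → ∑γγ≤p² p m (c * α ∙ v + w) (c * β ∙ v + w′)) ⟩
    ∑ (box q d) (λ _ → + p * + p)          ≡⟨ ∑-box-const q d (+ p * + p) ⟩
    + (q ℕ.^ d) * (+ p * + p)              ≡⟨ *-identityʳ _ ⟨
    + (q ℕ.^ d) * (+ p * + p) * 1ℤ         ≡⟨ cong (_*_ (+ (q ℕ.^ d) * (+ p * + p))) χ≡1 ⟨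
    + (q ℕ.^ d) * (+ p * + p) * χ (p ℕ.* m) (α -ᶻ β) ∎
    where open ≤-Reasoning
  ... | inj₁ χ≡0 = ≤-reflexive (trans correlation≡0 (sym
    (trans (cong (_*_ (+ (q ℕ.^ d) * (+ p * + p))) χ≡0) (*-zeroʳ (+ (q ℕ.^ d) * (+ p * + p))))))
    where
    open ≡-Reasoning
    n = p ℕ.* m
    difference : ∀ (c x y w w′ s : ℤ) → c * x + w + (- (c * y + w′) + s) ≡ c * (x - y) + (w - w′ + s)
    difference = solve-∀
    cancel : ∀ (a s : ℤ) → a + (- a + s) ≡ s
    cancel = solve-∀
    shifted : ∀ v → ∑< n (λ s → γ p m (c * α ∙ v + w + + s) * γ p m (c * β ∙ v + w′ + + s))
                  ≡ ∑< n (λ s → γ p m (c * (α -ᶻ β) ∙ v + (w - w′ + + s)) * γ p m (+ s))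
    shifted v = begin
      ∑< n (λ s → F (+ s))                              ≡⟨ ∑<-shift {n} {F} F-periodic (- b) ⟨
      ∑< n (λ s → F (- b + + s))                        ≡⟨ ∑<-cong n rewrite-args ⟩
      ∑< n (λ s → γ p m (c * (α -ᶻ β) ∙ v + (w - w′ + + s)) * γ p m (+ s)) ∎
      where
      a = c * α ∙ v + w
      b = c * β ∙ v + w′
      F : ℤ → ℤ
      F u = γ p m (a + u) * γ p m (b + u)
      F-periodic : Periodic n F
      F-periodic u = cong₂ _*_ (γ-periodic p m a u) (γ-periodic p m b u)
      rewrite-args : ∀ s → F (- b + + s) ≡ γ p m (c * (α -ᶻ β) ∙ v + (w - w′ + + s)) * γ p m (+ s)
      rewrite-args s = cong₂ (λ x y → γ p m x * γ p m y)
        (trans (difference c (α ∙ v) (β ∙ v) w w′ (+ s))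
               (cong (λ z → c * z + (w - w′ + + s)) (sym (∙-distribʳ-- α β v))))
        (cancel b (+ s))
    correlation≡0 : correlation p m q c α β w w′ ≡ 0ℤ
    correlation≡0 = begin
      correlation p m q c α β w w′
        ≡⟨ ∑-cong (box q d) shifted ⟩
      ∑ (box q d) (λ v → ∑< n (λ s → γ p m (c * (α -ᶻ β) ∙ v + (w - w′ + + s)) * γ p m (+ s)))
        ≡⟨ ∑-swap (box q d) (allFin n) _ ⟩
      ∑< n (λ s → ∑ (box q d) (λ v → γ p m (c * (α -ᶻ β) ∙ v + (w - w′ + + s)) * γ p m (+ s)))
        ≡⟨ ∑<-cong n (λ s → ∑-*ʳ (box q d) (λ v → γ p m (c * (α -ᶻ β) ∙ v + (w - w′ + + s))) (γ p m (+ s))) ⟩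
      ∑< n (λ s → ∑ (box q d) (λ v → γ p m (c * (α -ᶻ β) ∙ v + (w - w′ + + s))) * γ p m (+ s))
        ≡⟨ ∑-zero (allFin n) (λ s → cong (_* γ p m (+ toℕ s))
           (∑γ-box {p} {m} {q} {c} balanced (α -ᶻ β) χ≡0 (w - w′ + + toℕ s))) ⟩
      0ℤ ∎

  ∑-rotate : ∀ {A B C : Set} (xs : List A) (ys : List B) (zs : List C) (f : A → B → C → ℤ) →
    ∑ xs (λ x → ∑ ys (λ y → ∑ zs (f x y))) ≡ ∑ ys (λ y → ∑ zs (λ z → ∑ xs (λ x → f x y z)))
  ∑-rotate xs ys zs f = trans (∑-swap xs ys (λ x y → ∑ zs (f x y)))
                              (∑-cong ys (λ y → ∑-swap xs zs (λ x → f x y)))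

  -- After expansion only the pairs x ≡ x′ modulo pm survive. For each x the whole box contains rᵈ
  -- such x′, and uniqueness of E prevents it from containing more.
  second-moment : ∀ {p m q r c d} .{{_ : ℕ.NonZero p}} .{{_ : ℕ.NonZero m}} → q ≡ r ℕ.* (p ℕ.* m) →
    Balanced p m q c →
    ∀ (E : List (Vec (Fin q) d)) → Unique E → (w : Vec (Fin q) d → ℤ) →
    let G = λ v u → ∑ E (λ x → γ p m (c * ⟦ x ⟧ ∙ v + w x + u)) in
    ∑ (box q d) (λ v → ∑< (p ℕ.* m) (λ s → G v (+ s) * G v (+ s)))
      ≤ + length E * (+ (q ℕ.^ d) * (+ p * + p) * + (r ℕ.^ d))
  second-moment {p} {m} {q} {r} {c} {d} q≡rn balanced E unique w = begin
    ∑ (box q d) (λ v → ∑< n (λ s → G v (+ s) * G v (+ s)))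
      ≡⟨ ∑-cong (box q d) (λ v → ∑<-cong n (λ s → ∑-*-∑ E E (λ x → g x v (+ s)) (λ x → g x v (+ s)))) ⟩
    ∑ (box q d) (λ v → ∑< n (λ s → ∑ E (λ x → ∑ E (λ x′ → g x v (+ s) * g x′ v (+ s)))))
      ≡⟨ ∑-cong (box q d) (λ v → ∑-rotate (allFin n) E E (λ s x x′ → g x v (+ toℕ s) * g x′ v (+ toℕ s))) ⟩
    ∑ (box q d) (λ v → ∑ E (λ x → ∑ E (λ x′ → ∑< n (λ s → g x v (+ s) * g x′ v (+ s)))))
      ≡⟨ ∑-rotate (box q d) E E (λ v x x′ → ∑< n (λ s → g x v (+ s) * g x′ v (+ s))) ⟩
    ∑ E (λ x → ∑ E (λ x′ → correlation p m q c ⟦ x ⟧ ⟦ x′ ⟧ (w x) (w x′)))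
      ≤⟨ ∑-mono E (λ x → ∑-mono E (λ x′ → correlation≤ {p} {m} {q} {c} balanced ⟦ x ⟧ ⟦ x′ ⟧ (w x) (w x′))) ⟩
    ∑ E (λ x → ∑ E (λ x′ → M * χ n (⟦ x ⟧ -ᶻ ⟦ x′ ⟧)))
      ≤⟨ ∑-mono E bound ⟩
    ∑ E (λ _ → M * + (r ℕ.^ d))
      ≡⟨ ∑-const E (M * + (r ℕ.^ d)) ⟩
    + length E * (M * + (r ℕ.^ d)) ∎
    where
    open ≤-Reasoning
    n = p ℕ.* m
    M = + (q ℕ.^ d) * (+ p * + p)
    g : Vec (Fin q) d → Vec (Fin q) d → ℤ → ℤ
    g x v u = γ p m (c * ⟦ x ⟧ ∙ v + w x + u)
    G : Vec (Fin q) d → ℤ → ℤ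
    G v u = ∑ E (λ x → g x v u)
    M≡ : M ≡ + (q ℕ.^ d ℕ.* (p ℕ.* p))
    M≡ = trans (cong (_*_ (+ (q ℕ.^ d))) (sym (pos-* p p))) (sym (pos-* (q ℕ.^ d) (p ℕ.* p)))
    -- Rewriting `M` as a cast natural number makes its nonnegativity visible to instance search.
    *-monoˡ-M : ∀ {i j} → i ≤ j → M * i ≤ M * j
    *-monoˡ-M rewrite M≡ = *-monoˡ-≤-nonNeg (+ (q ℕ.^ d ℕ.* (p ℕ.* p)))
    bound : ∀ x → ∑ E (λ x′ → M * χ n (⟦ x ⟧ -ᶻ ⟦ x′ ⟧)) ≤ M * + (r ℕ.^ d)
    bound x = begin
      ∑ E (λ x′ → M * χ n (⟦ x ⟧ -ᶻ ⟦ x′ ⟧))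
        ≡⟨ ∑-*ˡ M E (λ x′ → χ n (⟦ x ⟧ -ᶻ ⟦ x′ ⟧)) ⟩
      M * ∑ E (λ x′ → χ n (⟦ x ⟧ -ᶻ ⟦ x′ ⟧))
        ≤⟨ *-monoˡ-M (∑-⊆ (box q d) unique (λ x′ _ → ∈-box x′) (λ x′ → 0≤χ n (⟦ x ⟧ -ᶻ ⟦ x′ ⟧))) ⟩
      M * ∑ (box q d) (λ x′ → χ n (⟦ x ⟧ -ᶻ ⟦ x′ ⟧))
        ≡⟨ cong (_*_ M) (∑χ {r} {n} {q} {d} {{ℕ.m*n≢0 p m}} q≡rn ⟦ x ⟧) ⟩
      M * + (r ℕ.^ d) ∎

  -- Each v in E comes with one particular shift σ(v). Its square is a nonnegative term of a full
  -- period of shifts, and E sits inside the box, so both sums may be enlarged.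
  sampled-second-moment : ∀ {p m q r c d} .{{_ : ℕ.NonZero p}} .{{_ : ℕ.NonZero m}} → q ≡ r ℕ.* (p ℕ.* m) →
    Balanced p m q c →
    ∀ (E : List (Vec (Fin q) d)) → Unique E → (w σ : Vec (Fin q) d → ℤ) →
    let G = λ v → ∑ E (λ x → γ p m (c * ⟦ x ⟧ ∙ v + w x + σ v)) in
    ∑ E (λ v → G v * G v) ≤ + length E * (+ (q ℕ.^ d) * (+ p * + p) * + (r ℕ.^ d))
  sampled-second-moment {p} {m} {q} {r} {c} {d} q≡rn balanced E unique w σ = begin
    ∑ E (λ v → G v (σ v) * G v (σ v))
      ≤⟨ ∑-mono E (λ v → ≤∑<-periodic {n} {λ u → G v u * G v u} {{ℕ.m*n≢0 p m}}
           (G²-periodic v) (λ u → 0≤i² (G v u)) (σ v)) ⟩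
    ∑ E (λ v → ∑< n (λ s → G v (+ s) * G v (+ s)))
      ≤⟨ ∑-⊆ (box q d) unique (λ v _ → ∈-box v) (λ v → ∑-nonneg (allFin n) (λ s → 0≤i² (G v (+ toℕ s)))) ⟩
    ∑ (box q d) (λ v → ∑< n (λ s → G v (+ s) * G v (+ s)))
      ≤⟨ second-moment {p} {m} {q} {r} {c} {d} q≡rn balanced E unique w ⟩
    + length E * (+ (q ℕ.^ d) * (+ p * + p) * + (r ℕ.^ d)) ∎
    where
    open ≤-Reasoning
    n = p ℕ.* m
    G : Vec (Fin q) d → ℤ → ℤ
    G v u = ∑ E (λ x → γ p m (c * ⟦ x ⟧ ∙ v + w x + u))
    G-periodic : ∀ v → Periodic n (G v)
    G-periodic v u = ∑-cong E (λ x → γ-periodic p m (c * ⟦ x ⟧ ∙ v + w x) u)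
    G²-periodic : ∀ v → Periodic n (λ u → G v u * G v u)
    G²-periodic v u = cong₂ _*_ (G-periodic v u) (G-periodic v u)

  -- Distances

  -- Kept as an unreduced integer, so that its divisibility by every pᵏ can be tested directly.
  distance : ∀ {q d} → Vec (Fin q) d → Vec (Fin q) d → ℤ
  distance []      []      = 0ℤ
  distance (a ∷ x) (b ∷ y) = (+ toℕ a - + toℕ b) * (+ toℕ a - + toℕ b) + distance x y

  -- Polarisation: only the first term couples x and y, and it is linear in y with coefficient
  -- vector -2x.
  distance-expand : ∀ {q d} (x y : Vec (Fin q) d) →
                    distance x y ≡ - + 2 * ⟦ x ⟧ ∙ y + ⟦ x ⟧ ∙ x + ⟦ y ⟧ ∙ y
  distance-expand []      []      = refl
  distance-expand (a ∷ x) (b ∷ y) =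
    trans (cong (_+_ ((+ toℕ a - + toℕ b) * (+ toℕ a - + toℕ b))) (distance-expand x y))
          (expand (+ toℕ a) (+ toℕ b) (⟦ x ⟧ ∙ y) (⟦ x ⟧ ∙ x) (⟦ y ⟧ ∙ y))
    where
    expand : ∀ (a b xy xx yy : ℤ) → (a - b) * (a - b) + (- + 2 * xy + xx + yy)
                                  ≡ - + 2 * (a * b + xy) + (a * a + xx) + (b * b + yy)
    expand = solve-∀

  lift-residue : ∀ {q} .{{_ : ℕ.NonZero q}} i → + q ∣ lift (residue {q} i) - i
  lift-residue {q} i = divides (- (i /ℕ q)) (begin
    lift (residue {q} i) - i                                ≡⟨ cong (λ k → + k - i) (toℕ-fromℕ< (n%ℕd<d i q)) ⟩
    + (i %ℕ q) - i                                          ≡⟨ cong (λ j → + (i %ℕ q) - j) (a≡a%ℕn+[a/ℕn]*n i q) ⟩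
    + (i %ℕ q) - (+ (i %ℕ q) + (i /ℕ q) * + q)              ≡⟨ cancel (+ (i %ℕ q)) (i /ℕ q) (+ q) ⟩
    - (i /ℕ q) * + q                                        ∎)
    where
    open ≡-Reasoning
    cancel : ∀ (r k q : ℤ) → r - (r + k * q) ≡ - k * q
    cancel = solve-∀

  lift-‖-‖ : ∀ {q d} .{{_ : ℕ.NonZero q}} (x y : Zmod^ q d) → + q ∣ lift ‖ x -ᵥ y ‖ - distance x y
  lift-‖-‖ {q} []      []      = lift-residue {q} 0ℤ
  lift-‖-‖ {q} (a ∷ x) (b ∷ y) =
    -- The four summands undo, in order, the reductions in `⊕`, `⊗`, `⊖` and in the tail; the
    -- factorisation (u - e)(u + e) turns u ≡ e into u² ≡ e².
    subst (+ q ∣_) (rearrange (lift ((u ⊗ u) ⊕ N)) (lift (u ⊗ u)) (lift N) (lift u)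
                              (lift a - lift b) (distance x y))
      (∣m∣n⇒∣m+n (lift-residue (lift (u ⊗ u) + lift N))
      (∣m∣n⇒∣m+n (lift-residue (lift u * lift u))
      (∣m∣n⇒∣m+n (∣m⇒∣m*n (lift u + (lift a - lift b)) (lift-residue (lift a - lift b)))
                 (lift-‖-‖ x y))))
    where
    u = a ⊖ b
    N = ‖ x -ᵥ y ‖
    rearrange : ∀ (s uu n u e D : ℤ) →
      s - (uu + n) + (uu - u * u + ((u - e) * (u + e) + (n - D))) ≡ s - (e * e + D)
    rearrange = solve-∀

  -- Both lifts lie in [0, q), so their difference is smaller than q in absolute value; a multiple
  -- of q of that size is 0.
  lift-injective : ∀ {q} .{{_ : ℕ.NonZero q}} (s t : Zmod q) → + q ∣ lift s - lift t → s ≡ t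
  lift-injective {q} s t q∣s-t = toℕ-injective (+-injective (i-j≡0⇒i≡j (lift s) (lift t) s-t≡0))
    where
    small : ∣ lift s - lift t ∣ ℕ.< q
    small rewrite m-n≡m⊖n (toℕ s) (toℕ t) =
      ℕ.≤-<-trans (∣m⊝n∣≤m⊔n (toℕ s) (toℕ t)) (ℕ.⊔-pres-<m (toℕ<n s) (toℕ<n t))
    zero-if-divisible : ∀ k → k ℕ.< q → q ℕ.∣ k → k ≡ 0
    zero-if-divisible zero    _   _   = refl
    zero-if-divisible (suc k) k<q q∣k = ⊥-elim (ℕ.>⇒∤ k<q q∣k)
    s-t≡0 : lift s - lift t ≡ 0ℤ
    s-t≡0 = ∣i∣≡0⇒i≡0 (zero-if-divisible _ small (∣⇒∣ᵤ q∣s-t))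

  -- If n = 1 + 2h, then b = n b + h (−2 b).
  odd-∣-2* : ∀ {n} → ¬ (2 ℕ.∣ n) → ∀ b → + n ∣ - + 2 * b → + n ∣ b
  odd-∣-2* {n} 2∤n b n∣-2b = subst (+ n ∣_) b≡ (∣m∣n⇒∣m+n (∣m⇒∣m*n b ∣-refl) (∣n⇒∣m*n (+ h) n∣-2b))
    where
    h = n ℕ./ 2
    n%2≡1 : ∀ r → r ℕ.< 2 → n ≡ r ℕ.+ h ℕ.* 2 → n ≡ 1 ℕ.+ h ℕ.* 2
    n%2≡1 zero          _ n≡ = ⊥-elim (2∤n (ℕ.divides h n≡))
    n%2≡1 (suc zero)    _ n≡ = n≡
    n%2≡1 (suc (suc r)) (ℕ.s≤s (ℕ.s≤s ())) _
    +n≡ : + n ≡ 1ℤ + + h * + 2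
    +n≡ = trans (cong +_ (n%2≡1 (n ℕ.% 2) (ℕ.m%n<n n 2) (ℕ.m≡m%n+[m/n]*n n 2)))
                (cong (_+_ 1ℤ) (pos-* h 2))
    collect : ∀ (h b : ℤ) → (1ℤ + h * + 2) * b + h * (- + 2 * b) ≡ b
    collect = solve-∀
    b≡ : + n * b + + h * (- + 2 * b) ≡ b
    b≡ = trans (cong (λ z → z * b + + h * (- + 2 * b)) +n≡) (collect (+ h) b)

  -- Oddness passes from q to its divisor n = pᵏ⁺¹, so n ∤ b gives n ∤ -2b; then `solve-top-digit`
  -- provides the shift that moves the linear form by pᵏ modulo n.
  balanced : ∀ {p q} → Prime p → ∀ k → p ℕ.^ suc k ℕ.∣ q → ¬ (2 ℕ.∣ q) → Balanced p (p ℕ.^ k) q (- + 2)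
  balanced {p} {q} p-prime k n∣q 2∤q b n∤b =
    let n∤-2b = n∤b ∘ odd-∣-2* (λ 2∣n → 2∤q (ℕ.∣-trans 2∣n n∣q)) b
        c , n∣ = solve-top-digit p-prime k (- + 2 * b) n∤-2b
    in ∑γ-linear {p} {p ℕ.^ k} {q} (∣ᵤ⇒∣ n∣q) (- + 2 * b) c n∣
    where
    instance
      _ = prime⇒nonZero p-prime
      _ = ℕ.m^n≢0 p k

  -- Weighted counts at the levels pᵏ and their increments

  level : ∀ {q d} → ℕ → List (Vec (Fin q) d) → ℤ → ℕ → Vec (Fin q) d → ℤ
  level p E t k y = + (p ℕ.^ k) * ∑ E (λ x → δ (p ℕ.^ k) (distance x y - t))

  level-zero : ∀ {q d} p (E : List (Vec (Fin q) d)) t y → level p E t 0 y ≡ + length E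
  level-zero p E t y = begin
    1ℤ * ∑ E (λ x → δ 1 (distance x y - t))    ≡⟨ *-identityˡ _ ⟩
    ∑ E (λ x → δ 1 (distance x y - t))        
      ≡⟨ ∑-cong E (λ x → δ-yes (divides (distance x y - t) (sym (*-identityʳ _)))) ⟩
    ∑ E (λ _ → 1ℤ)                             ≡⟨ ∑-const E 1ℤ ⟩
    + length E * 1ℤ                            ≡⟨ *-identityʳ (+ length E) ⟩
    + length E                                 ∎
    where open ≡-Reasoning

  -- The weight pᵏ serves this identity: with m = pᵏ, termwise pm[pm ∣ u] - m[m ∣ u] is m times `γ`.
  level-step : ∀ {q d} p (E : List (Vec (Fin q) d)) t k y →
    level p E t (suc k) y - level p E t k y ≡ + (p ℕ.^ k) * ∑ E (λ x → γ p (p ℕ.^ k) (distance x y - t))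
  level-step p E t k y = begin
    + (p ℕ.* m) * S′ - + m * S              ≡⟨ cong (λ z → z * S′ - + m * S) (pos-* p m) ⟩
    + p * + m * S′ - + m * S                ≡⟨ factor (+ p) (+ m) S′ S ⟩
    + m * (+ p * S′ - S)                    ≡⟨ cong (λ z → + m * (z - S)) (∑-*ˡ (+ p) E (λ x → δ (p ℕ.* m) (u x))) ⟨
    + m * (∑ E (λ x → + p * δ (p ℕ.* m) (u x)) - S)
                                            ≡⟨ cong (_*_ (+ m)) (∑-- E (λ x → + p * δ (p ℕ.* m) (u x)) (λ x → δ m (u x))) ⟨
    + m * ∑ E (λ x → γ p m (u x))           ∎
    where
    open ≡-Reasoning
    m = p ℕ.^ k
    u = λ x → distance x y - t
    S′ = ∑ E (λ x → δ (p ℕ.* m) (u x))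
    S  = ∑ E (λ x → δ m (u x))
    factor : ∀ (p m a b : ℤ) → p * m * a - m * b ≡ m * (p * a - b)
    factor = solve-∀

  increment : ∀ {q d} → ℕ → List (Vec (Fin q) d) → ℤ → ℕ → Vec (Fin q) d → ℤ
  increment p E t k y = level p E t (suc k) y - level p E t k y

  ^-distribʳ-* : ∀ k m n → (m ℕ.* n) ℕ.^ k ≡ m ℕ.^ k ℕ.* n ℕ.^ k
  ^-distribʳ-* zero    m n = refl
  ^-distribʳ-* (suc k) m n = trans (cong (ℕ._*_ (m ℕ.* n)) (^-distribʳ-* k m n))
                                   (ℕ.[m*n]*[o*p]≡[m*o]*[n*p] m n (m ℕ.^ k) (n ℕ.^ k))

  -- pᵉ m² p² rᵈ ≤ qᵈ for q = r p m, because p ≤ p m.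
  energy-arithmetic : ∀ p m r e q N .{{_ : ℕ.NonZero m}} → q ≡ r ℕ.* (p ℕ.* m) →
    let d = 2 ℕ.+ e in
    p ℕ.^ e ℕ.* (m ℕ.* m ℕ.* (N ℕ.* (q ℕ.^ d ℕ.* (p ℕ.* p) ℕ.* r ℕ.^ d))) ℕ.≤ N ℕ.* (q ℕ.^ d ℕ.* q ℕ.^ d)
  energy-arithmetic p m r e q N q≡rP = begin
    p ℕ.^ e ℕ.* (m ℕ.* m ℕ.* (N ℕ.* (Q ℕ.* (p ℕ.* p) ℕ.* R)))
      ≡⟨ rearrange (p ℕ.^ e) m N Q p R ⟩
    N ℕ.* (Q ℕ.* (R ℕ.* (P ℕ.* (P ℕ.* p ℕ.^ e))))
      ≤⟨ ℕ.*-monoʳ-≤ N (ℕ.*-monoʳ-≤ Q (ℕ.*-monoʳ-≤ R (ℕ.*-monoʳ-≤ P (ℕ.*-monoʳ-≤ P (ℕ.^-monoˡ-≤ e (ℕ.m≤m*n p m)))))) ⟩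
    N ℕ.* (Q ℕ.* (R ℕ.* P ℕ.^ d))
      ≡⟨ cong (λ z → N ℕ.* (Q ℕ.* z)) (^-distribʳ-* d r P) ⟨
    N ℕ.* (Q ℕ.* (r ℕ.* P) ℕ.^ d)
      ≡⟨ cong (λ z → N ℕ.* (Q ℕ.* z ℕ.^ d)) q≡rP ⟨
    N ℕ.* (Q ℕ.* Q) ∎
    where
    open ℕ.≤-Reasoning
    d = 2 ℕ.+ e
    P = p ℕ.* m
    Q = q ℕ.^ d
    R = r ℕ.^ d
    rearrange : ∀ (pe m N Q p R : ℕ) → pe ℕ.* (m ℕ.* m ℕ.* (N ℕ.* (Q ℕ.* (p ℕ.* p) ℕ.* R)))
      ≡ N ℕ.* (Q ℕ.* (R ℕ.* (p ℕ.* m ℕ.* (p ℕ.* m ℕ.* pe))))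
    rearrange = solveℕ-∀

  -- The second moment is multiplied by m², since the increment is m times a sum of `γ`. The saving
  -- pᵉ, e = d - 2, stands on the left to avoid division.
  increment-energy : ∀ {p q r} k e → Prime p → q ≡ r ℕ.* (p ℕ.^ suc k) → ¬ (2 ℕ.∣ q) →
    let d = 2 ℕ.+ e in
    ∀ (E : List (Vec (Fin q) d)) → Unique E → ∀ t →
    + (p ℕ.^ e) * ∑ E (λ y → increment p E t k y * increment p E t k y)
      ≤ + (length E ℕ.* (q ℕ.^ d ℕ.* q ℕ.^ d))
  increment-energy {p} {q} {r} k e p-prime q≡rn 2∤q E unique t = begin
    + (p ℕ.^ e) * ∑ E (λ y → increment p E t k y * increment p E t k y)
      ≡⟨ cong (_*_ (+ (p ℕ.^ e))) (∑-cong E (λ y → cong (λ z → z * z)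
           (trans (level-step p E t k y) (cong (_*_ (+ m)) (∑-cong E (λ x → cong (γ p m) (split x y))))))) ⟩
    + (p ℕ.^ e) * ∑ E (λ y → (+ m * G y) * (+ m * G y))
      ≡⟨ cong (_*_ (+ (p ℕ.^ e))) (∑-cong E (λ y → square (+ m) (G y))) ⟩
    + (p ℕ.^ e) * ∑ E (λ y → + m * + m * (G y * G y))
      ≡⟨ cong (_*_ (+ (p ℕ.^ e))) (∑-*ˡ (+ m * + m) E (λ y → G y * G y)) ⟩
    + (p ℕ.^ e) * (+ m * + m * ∑ E (λ y → G y * G y))
      ≡⟨ cong (λ z → + (p ℕ.^ e) * (z * ∑ E (λ y → G y * G y))) (pos-* m m) ⟨
    + (p ℕ.^ e) * (+ (m ℕ.* m) * ∑ E (λ y → G y * G y))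
      ≤⟨ *-monoˡ-≤-nonNeg (+ (p ℕ.^ e)) (*-monoˡ-≤-nonNeg (+ (m ℕ.* m))
           -- Polarisation fixes the data: coefficient -2, offset ‖x‖ depending on x alone, and
           -- shift ‖y‖ - t depending on y alone.
           (sampled-second-moment {p} {m} {q} {r} { - + 2} {d} q≡rn
             (balanced p-prime k (ℕ.divides r q≡rn) 2∤q) E unique (λ x → ⟦ x ⟧ ∙ x) (λ y → ⟦ y ⟧ ∙ y - t))) ⟩
    + (p ℕ.^ e) * (+ (m ℕ.* m) * (+ length E * (+ (q ℕ.^ d) * (+ p * + p) * + (r ℕ.^ d))))
      ≡⟨ cong (λ z → + (p ℕ.^ e) * (+ (m ℕ.* m) * (+ length E * z))) to-ℕ ⟩
    + (p ℕ.^ e) * (+ (m ℕ.* m) * (+ length E * + X))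
      ≡⟨ cong (λ z → + (p ℕ.^ e) * (+ (m ℕ.* m) * z)) (pos-* (length E) X) ⟨
    + (p ℕ.^ e) * (+ (m ℕ.* m) * + (length E ℕ.* X))
      ≡⟨ cong (_*_ (+ (p ℕ.^ e))) (pos-* (m ℕ.* m) (length E ℕ.* X)) ⟨
    + (p ℕ.^ e) * + (m ℕ.* m ℕ.* (length E ℕ.* X))
      ≡⟨ pos-* (p ℕ.^ e) (m ℕ.* m ℕ.* (length E ℕ.* X)) ⟨
    + (p ℕ.^ e ℕ.* (m ℕ.* m ℕ.* (length E ℕ.* X)))
      ≤⟨ +≤+ (energy-arithmetic p m r e q (length E) q≡rn) ⟩
    + (length E ℕ.* (q ℕ.^ d ℕ.* q ℕ.^ d)) ∎
    where
    open ≤-Reasoning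
    instance
      p≢0 = prime⇒nonZero p-prime
      m≢0 = ℕ.m^n≢0 p k
    d = 2 ℕ.+ e
    m = p ℕ.^ k
    X = q ℕ.^ d ℕ.* (p ℕ.* p) ℕ.* r ℕ.^ d
    G : Vec (Fin q) d → ℤ
    G y = ∑ E (λ x → γ p m (- + 2 * ⟦ x ⟧ ∙ y + ⟦ x ⟧ ∙ x + (⟦ y ⟧ ∙ y - t)))
    split : ∀ x y → distance x y - t ≡ - + 2 * ⟦ x ⟧ ∙ y + ⟦ x ⟧ ∙ x + (⟦ y ⟧ ∙ y - t)
    split x y = trans (cong (_- t) (distance-expand x y)) (+-assoc (- + 2 * ⟦ x ⟧ ∙ y + ⟦ x ⟧ ∙ x) (⟦ y ⟧ ∙ y) (- t))
    square : ∀ (a b : ℤ) → (a * b) * (a * b) ≡ a * a * (b * b)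
    square = solve-∀
    to-ℕ : + (q ℕ.^ d) * (+ p * + p) * + (r ℕ.^ d) ≡ + X
    to-ℕ = sym (trans (pos-* (q ℕ.^ d ℕ.* (p ℕ.* p)) (r ℕ.^ d))
      (cong (_* + (r ℕ.^ d)) (trans (pos-* (q ℕ.^ d) (p ℕ.* p)) (cong (_*_ (+ (q ℕ.^ d))) (pos-* p p)))))

  -- At each y in E the increments telescope to -|E|. Summation over y puts a further factor |E| on
  -- both sides; it stays there because E may still be empty.
  missing-distance : ∀ {p ℓ q} e → Prime p → q ≡ p ℕ.^ ℓ → ¬ (2 ℕ.∣ q) →
    let d = 2 ℕ.+ e in
    ∀ (E : List (Vec (Fin q) d)) → Unique E → ∀ t →
    (∀ x y → x ∈ E → y ∈ E → ¬ (+ q ∣ distance x y - t)) →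
    p ℕ.^ e ℕ.* (length E ℕ.* (length E ℕ.* length E))
      ℕ.≤ ℓ ℕ.* (ℓ ℕ.* (length E ℕ.* (q ℕ.^ d ℕ.* q ℕ.^ d)))
  missing-distance {p} {ℓ} {q} e p-prime q≡pˡ 2∤q E unique t missing = drop‿+≤+ (begin
    + (p ℕ.^ e ℕ.* (N ℕ.* (N ℕ.* N)))
      ≡⟨ trans (pos-* (p ℕ.^ e) (N ℕ.* (N ℕ.* N))) (cong (_*_ (+ (p ℕ.^ e)))
           (trans (pos-* N (N ℕ.* N)) (cong (_*_ (+ N)) (pos-* N N)))) ⟩
    + (p ℕ.^ e) * (+ N * (+ N * + N))
      ≡⟨ cong (_*_ (+ (p ℕ.^ e))) (∑-const E (+ N * + N)) ⟨
    + (p ℕ.^ e) * ∑ E (λ _ → + N * + N)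
      ≤⟨ *-monoˡ-≤-nonNeg (+ (p ℕ.^ e)) (∑-mono-∈ E cauchy-schwarz) ⟩
    + (p ℕ.^ e) * ∑ E (λ y → + ℓ * ∑< ℓ (λ k → D k y * D k y))
      ≡⟨ cong (_*_ (+ (p ℕ.^ e))) (∑-*ˡ (+ ℓ) E (λ y → ∑< ℓ (λ k → D k y * D k y))) ⟩
    + (p ℕ.^ e) * (+ ℓ * ∑ E (λ y → ∑< ℓ (λ k → D k y * D k y)))
      ≡⟨ *-left (+ (p ℕ.^ e)) (+ ℓ) _ ⟩
    + ℓ * (+ (p ℕ.^ e) * ∑ E (λ y → ∑< ℓ (λ k → D k y * D k y)))
      ≡⟨ cong (λ z → + ℓ * (+ (p ℕ.^ e) * z)) (∑-swap E (allFin ℓ) (λ y k → D (toℕ k) y * D (toℕ k) y)) ⟩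
    + ℓ * (+ (p ℕ.^ e) * ∑< ℓ (λ k → ∑ E (λ y → D k y * D k y)))
      ≡⟨ cong (_*_ (+ ℓ)) (∑-*ˡ (+ (p ℕ.^ e)) (allFin ℓ) (λ k → ∑ E (λ y → D (toℕ k) y * D (toℕ k) y))) ⟨
    + ℓ * ∑< ℓ (λ k → + (p ℕ.^ e) * ∑ E (λ y → D k y * D k y))
      ≤⟨ *-monoˡ-≤-nonNeg (+ ℓ) (∑-mono (allFin ℓ) λ k →
           increment-energy {r = p ℕ.^ (ℓ ℕ.∸ suc (toℕ k))} (toℕ k) e p-prime (q≡rn k) 2∤q E unique t) ⟩
    + ℓ * ∑< ℓ (λ _ → + bound)
      ≡⟨ cong (_*_ (+ ℓ)) (∑<-const ℓ (+ bound)) ⟩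
    + ℓ * (+ ℓ * + bound)
      ≡⟨ trans (pos-* ℓ (ℓ ℕ.* bound)) (cong (_*_ (+ ℓ)) (pos-* ℓ bound)) ⟨
    + (ℓ ℕ.* (ℓ ℕ.* bound)) ∎)
    where
    open ≤-Reasoning
    N = length E
    d = 2 ℕ.+ e
    bound = N ℕ.* (q ℕ.^ d ℕ.* q ℕ.^ d)
    D = increment p E t
    *-left : ∀ (a b c : ℤ) → a * (b * c) ≡ b * (a * c)
    *-left = solve-∀
    -- The truncated subtraction is exact because k < ℓ.
    q≡rn : ∀ (k : Fin ℓ) → q ≡ p ℕ.^ (ℓ ℕ.∸ suc (toℕ k)) ℕ.* p ℕ.^ suc (toℕ k)
    q≡rn k = trans q≡pˡ (trans (cong (p ℕ.^_) (sym (ℕ.m∸n+n≡m (toℕ<n k))))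
                           (ℕ.^-distribˡ-+-* p (ℓ ℕ.∸ suc (toℕ k)) (suc (toℕ k))))
    level-ℓ : ∀ y → y ∈ E → level p E t ℓ y ≡ 0ℤ
    level-ℓ y y∈E = trans (cong (_*_ (+ (p ℕ.^ ℓ)))
      (trans (∑-cong-∈ E (λ x x∈E →
              δ-no (missing x y x∈E y∈E ∘ subst (λ n → + n ∣ distance x y - t) (sym q≡pˡ))))
            (∑-zero E (λ _ → refl))))
      (*-zeroʳ (+ (p ℕ.^ ℓ)))
    total : ∀ y → y ∈ E → ∑< ℓ (λ k → D k y) ≡ - + N
    total y y∈E = trans (∑<-telescope ℓ (λ k → level p E t k y))
      (trans (cong₂ _-_ (level-ℓ y y∈E) (level-zero p E t y)) (+-identityˡ (- + N)))
    neg² : ∀ (a : ℤ) → - a * - a ≡ a * a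
    neg² = solve-∀
    cauchy-schwarz : ∀ y → y ∈ E → + N * + N ≤ + ℓ * ∑< ℓ (λ k → D k y * D k y)
    cauchy-schwarz y y∈E = begin
      + N * + N                                        ≡⟨ neg² (+ N) ⟨
      - + N * - + N                                    ≡⟨ cong (λ z → z * z) (total y y∈E) ⟨
      ∑< ℓ (λ k → D k y) * ∑< ℓ (λ k → D k y)          ≤⟨ ∑²≤length*∑² (allFin ℓ) (λ k → D (toℕ k) y) ⟩
      + length (allFin ℓ) * ∑< ℓ (λ k → D k y * D k y)
        ≡⟨ cong (λ n → + n * ∑< ℓ (λ k → D k y * D k y)) (length-tabulate {n = ℓ} (λ i → i)) ⟩
      + ℓ * ∑< ℓ (λ k → D k y * D k y)                 ∎

-- Conflict with the density hypothesis

open DistanceEnergy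
  using (distance; lift-‖-‖; lift-injective; ^-distribʳ-*; missing-distance)
import Data.Integer as ℤ
import Data.Integer.Divisibility.Signed as ℤ
open import Data.Integer.Tactic.RingSolver using () renaming (solve-∀ to solveℤ-∀)
open import Data.Nat
  using (NonZero; _+_; _*_; _∸_; _^_; _<_; _≤_; _≥_; _>_; s≤s; z≤n)
open import Data.Nat.Divisibility using (_∣_)
open import Data.Nat.Properties hiding (_≟_)
open import Data.Nat.Tactic.RingSolver using (solve-∀)

-- The energy bound is raised to the power ℓ, so that p^((d-2)ℓ) = q^(d-2). The density exponent a
-- satisfies a + (d - 2) = 2ℓd, so this factor completes qᵃ to q^(2ℓd). Cancelling leaves (ℓ+1)^(2ℓ)
-- ≤ ℓ^(2ℓ), which is false.
density-contradiction : ∀ p e l N → .{{NonZero p}} →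
  let d = 2 + suc e ; ℓ = suc l ; q = p ^ ℓ in
  p ^ suc e * (N * (N * N)) ≤ ℓ * (ℓ * (N * (q ^ d * q ^ d))) →
  N ≥ (1 * (ℓ + 1)) · q ^[ ((2 * ℓ ∸ 1) * d + 2) / (2 * ℓ) ] → ⊥
-- For N = 0 the density hypothesis alone is absurd: it bounds a positive power of q by 0^(2ℓ) = 0.
density-contradiction p e l zero    _     dense = <⇒≱ (m^n>0 q {{m^n≢0 p (suc l)}} a)
  (≤-trans (m≤n*m (q ^ a) ((1 * (suc l + 1)) ^ (2 * suc l)) {{m^n≢0 (1 * (suc l + 1)) (2 * suc l)}}) dense)
  where
  q = p ^ suc l
  a = (2 * suc l ∸ 1) * (3 + e) + 2
density-contradiction p e l N@(suc _) energy dense =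
  <⇒≱ ℓ^2ℓ<[ℓ+1]^2ℓ (*-cancelʳ-≤ _ _ (Q ^ (2 * ℓ)) {{m^n≢0 Q (2 * ℓ) {{Q≢0}}}} (begin
  (1 * (ℓ + 1)) ^ (2 * ℓ) * Q ^ (2 * ℓ)
    ≡⟨ cong ((1 * (ℓ + 1)) ^ (2 * ℓ) *_) Q^2ℓ ⟩
  (1 * (ℓ + 1)) ^ (2 * ℓ) * (q ^ a * q ^ e′)
    ≡⟨ *-assoc ((1 * (ℓ + 1)) ^ (2 * ℓ)) (q ^ a) (q ^ e′) ⟨
  (1 * (ℓ + 1)) ^ (2 * ℓ) * q ^ a * q ^ e′
    ≤⟨ *-monoˡ-≤ (q ^ e′) dense ⟩
  N ^ (2 * ℓ) * q ^ e′
    ≡⟨ *-comm (N ^ (2 * ℓ)) (q ^ e′) ⟩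
  q ^ e′ * N ^ (2 * ℓ)
    ≡⟨ cong₂ _*_ q^e′ (sym (^-*-assoc N 2 ℓ)) ⟩
  (p ^ e′) ^ ℓ * (N ^ 2) ^ ℓ
    ≡⟨ ^-distribʳ-* ℓ (p ^ e′) (N ^ 2) ⟨
  (p ^ e′ * N ^ 2) ^ ℓ
    ≤⟨ ^-monoˡ-≤ ℓ p^e′N²≤ ⟩
  ((ℓ * Q) ^ 2) ^ ℓ
    ≡⟨ ^-*-assoc (ℓ * Q) 2 ℓ ⟩
  (ℓ * Q) ^ (2 * ℓ)
    ≡⟨ ^-distribʳ-* (2 * ℓ) ℓ Q ⟩
  ℓ ^ (2 * ℓ) * Q ^ (2 * ℓ) ∎))
  where
  open ≤-Reasoning
  e′ = suc e
  d = 2 + e′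
  ℓ = suc l
  q = p ^ ℓ
  Q = q ^ d
  a = (2 * ℓ ∸ 1) * d + 2
  Q≢0 : NonZero Q
  Q≢0 = m^n≢0 q d {{m^n≢0 p ℓ}}
  exponents : ∀ l e → (2 + e) * (2 * suc l) ≡ ((2 * l + 1) * (2 + e) + 2) + e
  exponents = solve-∀
  2ℓ∸1 : ∀ l → 2 * suc l ∸ 1 ≡ 2 * l + 1
  2ℓ∸1 l = cong (_∸ 1) (2*suc l)
    where
    2*suc : ∀ l → 2 * suc l ≡ suc (2 * l + 1)
    2*suc = solve-∀
  Q^2ℓ : Q ^ (2 * ℓ) ≡ q ^ a * q ^ e′
  Q^2ℓ = trans (^-*-assoc q d (2 * ℓ)) (trans
    (cong (q ^_) (trans (exponents l e′) (cong (λ c → c * d + 2 + e′) (sym (2ℓ∸1 l)))))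
    (^-distribˡ-+-* q a e′))
  q^e′ : q ^ e′ ≡ (p ^ e′) ^ ℓ
  q^e′ = trans (^-*-assoc p ℓ e′) (trans (cong (p ^_) (*-comm ℓ e′)) (sym (^-*-assoc p e′ ℓ)))
  ℓ^2ℓ<[ℓ+1]^2ℓ : ℓ ^ (2 * ℓ) < (1 * (ℓ + 1)) ^ (2 * ℓ)
  ℓ^2ℓ<[ℓ+1]^2ℓ = ^-monoˡ-< (2 * ℓ) (≤-reflexive (suc≡ ℓ))
    where
    suc≡ : ∀ ℓ → suc ℓ ≡ 1 * (ℓ + 1)
    suc≡ = solve-∀
  left : ∀ P N → P * (N * (N * 1)) * N ≡ P * (N * (N * N))
  left = solve-∀
  right : ∀ ℓ N Q → ℓ * (ℓ * (N * (Q * Q))) ≡ (ℓ * Q) * ((ℓ * Q) * 1) * N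
  right = solve-∀
  p^e′N²≤ : p ^ e′ * N ^ 2 ≤ (ℓ * Q) ^ 2
  -- Here N is a successor, so the common factor |E| can be cancelled.
  p^e′N²≤ = *-cancelʳ-≤ _ _ N (≤-trans (≤-reflexive (left (p ^ e′) N))
                               (≤-trans energy (≤-reflexive (right ℓ N Q))))

corollary1p7 : ∀ (d : ℕ) → d > 2 →
    ∃ λ (C : ℕ) → C > 0 ×
    (∀ (p ℓ q : ℕ) .{{_ : NonZero q}} →
    Prime p → ℓ ≥ 1 → q ≡ p ^ ℓ → ¬ (2 ∣ q) →
    ∀ (E : List (Zmod^ q d)) → Unique E →
    length E ≥ (C * (ℓ + 1)) · q ^[ ((2 * ℓ ∸ 1) * d + 2) / (2 * ℓ) ] →
    Δ E ≐ U)
corollary1p7 (suc zero) (s≤s ())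
corollary1p7 (suc (suc zero)) (s≤s (s≤s ()))
-- `C` = 1 suffices because the strict gap between ℓ + 1 and ℓ already yields the contradiction.
corollary1p7 (suc (suc (suc e))) _ = 1 , s≤s z≤n , all-distances
  where
  d = 3 + e
  all-distances : ∀ (p ℓ q : ℕ) .{{_ : NonZero q}} →
    Prime p → ℓ ≥ 1 → q ≡ p ^ ℓ → ¬ (2 ∣ q) →
    ∀ (E : List (Zmod^ q d)) → Unique E →
    length E ≥ (1 * (ℓ + 1)) · q ^[ ((2 * ℓ ∸ 1) * d + 2) / (2 * ℓ) ] →
    Δ E ≐ U
  all-distances p (suc l) q p-prime _ refl 2∤q E unique dense = (λ _ → tt) , λ {t} _ → attained t
    where
    attained : ∀ t → Δ E t
    -- A search through all pairs decides whether t is attained, so excluding failure leaves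
    -- explicit witnesses.
    attained t with any? (λ x → any? (λ y → t ≟ ‖ x -ᵥ y ‖) E) E
    ... | yes found =
      let x , x∈E , found-y = find found
          y , y∈E , t≡      = find found-y
      in x , y , x∈E , y∈E , t≡
    ... | no ¬found = ⊥-elim (density-contradiction p e l (length E) {{prime⇒nonZero p-prime}}
      (missing-distance {p} {suc l} {q} (suc e) p-prime refl 2∤q E unique (lift t) missing) dense)
      where
      rearrange : ∀ a b c → (a ℤ.- b) ℤ.+ (b ℤ.- c) ≡ a ℤ.- c
      rearrange = solveℤ-∀
      missing : ∀ x y → x ∈ E → y ∈ E → ¬ (ℤ.+ q ℤ.∣ distance x y ℤ.- lift t)
      missing x y x∈E y∈E q∣ = ¬found (lose x∈E (lose y∈E (sym
        (lift-injective ‖ x -ᵥ y ‖ t (subst (ℤ.+ q ℤ.∣_) (rearrange (lift ‖ x -ᵥ y ‖) (distance x y) (lift t))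
          (ℤ.∣m∣n⇒∣m+n (lift-‖-‖ x y) q∣))))))
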